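{- Let $\Delta,k$ be integers with $k\ge 1$, $\Delta\ge k+3$ and $\Delta$ even. Then there is a gadget, i.e. a realizable instance of $\Delta$-$k$-DiTTR (so that $D_{u,v}\ge\hat d(u,v)+k$ for all $u,v$), that enforces $\lambda(e_1,e_2)=\lambda(e_2,e_1)$ for some pair of adjacent vertices $(e_1,e_2)$.
   Context: All graphs are finite. A $\Delta$-periodic labeling of a directed graph $G=(V,E)$ is a map $\lambda:E\to\{0,1,\dots,\Delta-1\}$; edge $e$ is then active exactly at the times $\lambda(e)+i\Delta$, $i\in\mathbb{N}_0$. A temporal $s$-$z$-path is a sequence $(v_{i-1},v_i,t_i)_{i=1}^{\ell}$ with $v_0=s$, $v_\ell=z$, pairwise distinct vertices $v_0,\dots,v_\ell$, $(v_{i-1},v_i)\in E$ active at time $t_i$ for every $i$, and $t_1<t_2<\dots<t_\ell$ (strictly increasing). Its duration is $t_\ell+1-t_1$. A fastest temporal path is one of minimum duration. $\hat d(u,v)$ is the distance from $u$ to $v$ in the static graph $G$ (all edges have unit length). A bidirected tree is the directed graph obtained from an undirected tree by replacing each edge $\{u,v\}$ by the two directed edges $(u,v),(v,u)$ (which may get different labels). For integers $\Delta\ge1,k\ge0$, an instance of $\Delta$-$k$-DiTTR consists of a bidirected tree $G=(V,E)$ and a matrix $D$ indexed by $V\times V$ with entries positive integers or $\infty$ (no restriction) such that $D_{u,v}\ge\hat d(u,v)+k$ for all $u,v$. A valid labeling is a $\Delta$-periodic labeling $\lambda$ of $E$ such that, for all $u,v\in V$, the duration of a fastest temporal path from $u$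 to $v$ is at most $D_{u,v}$; the instance is realizable if a valid labeling exists. Diagonal entries of $D$ play no role; all conditions on $D$ are for distinct vertices. An instance enforces $\lambda(e_1,e_2)=\lambda(e_2,e_1)$ if this equality holds for every valid labeling $\lambda$. -}

module Defs where

open import Data.Bool using (Bool; T)
open import Data.Fin using (Fin; toℕ)
open import Data.List using (List; []; _∷_)
open import Data.List.Relation.Unary.Linked using (Linked)
open import Data.List.Relation.Unary.Unique.Propositional using (Unique)
open import Data.Nat using (ℕ; suc; _+_; _*_; _∸_; _≤_; _<_)
open import Data.Product using (Σ-syntax; ∃-syntax; _×_)
open import Relation.Binary.Construct.Add.Supremum.NonStrict _≤_ using (_≤⁺_)
open import Relation.Binary.Construct.Closure.ReflexiveTransitive using (Star; ε; _◅_)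
open import Relation.Binary.Construct.Closure.Transitive using (TransClosure; [_]; _∷_)
open import Relation.Binary.PropositionalEquality using (_≡_; _≢_)
open import Relation.Nullary using (¬_)
open import Relation.Nullary.Construct.Add.Supremum using (_⁺) renaming ([_] to fin)

record Digraph : Set where
  field
    order : ℕ
    arc   : Fin order → Fin order → Bool

  Vertex : Set
  Vertex = Fin order

  -- Proofs of `T b` are unique, so an element of `Edge u v` carries no
  -- information beyond the pair (u , v).
  Edge : Vertex → Vertex → Set
  Edge u v = T (arc u v)

  Walk : Vertex → Vertex → Set
  Walk = Star Edge

  length : ∀ {u v} → Walk u v → ℕ
  length ε       = 0
  length (_ ◅ w) = suc (length w)

  vertices : ∀ {u v} → Walk u v → List Vertex
  vertices {u} ε       = u ∷ []
  vertices {u} (_ ◅ w) = u ∷ vertices w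

  IsPath : ∀ {u v} → Walk u v → Set
  IsPath w = Unique (vertices w)

  IsDistance : Vertex → Vertex → ℕ → Set
  IsDistance u v d =
      (Σ[ w ∈ Walk u v ] IsPath w × length w ≡ d)
    × (∀ (w : Walk u v) → IsPath w → d ≤ length w)

record SimpleGraph : Set where
  field
    order       : ℕ
    adj         : Fin order → Fin order → Bool
    symmetric   : ∀ u v → T (adj u v) → T (adj v u)
    irreflexive : ∀ u → ¬ T (adj u u)

-- The undirected edge {u , v} is already present in `adj` in both
-- orientations; read as a digraph these become the two arcs (u , v) and (v , u).
bidirected : SimpleGraph → Digraph
bidirected G = record { order = SimpleGraph.order G ; arc = SimpleGraph.adj G }

record IsTree (G : SimpleGraph) : Set where
  open Digraph (bidirected G)
  field
    nonempty  : Vertex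
    connected : ∀ u v → Walk u v
    -- A cycle is a path with at least two edges together with an edge
    -- joining its last vertex to its first.
    acyclic   : ∀ {u v} (w : Walk u v) → IsPath w → 2 ≤ length w → ¬ Edge v u

module Temporal (G : Digraph) (Δ : ℕ) where
  open Digraph G

  Labeling : Set
  Labeling = ∀ u v → Edge u v → Fin Δ

  module _ (lab : Labeling) where

    record TimeEdge (u v : Vertex) : Set where
      field
        edge   : Edge u v
        time   : ℕ
        active : ∃[ i ] time ≡ toℕ (lab u v edge) + i * Δ

    -- Temporal walks have at least one edge, so that the first and last
    -- time, and hence the duration, are defined.
    TemporalWalk : Vertex → Vertex → Set
    TemporalWalk = TransClosure TimeEdge

  module _ {lab : Labeling} where
    open TimeEdge

    visited : ∀ {u v} → TemporalWalk lab u v → List Vertex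
    visited {u} {v} [ _ ]   = u ∷ v ∷ []
    visited {u}     (_ ∷ p) = u ∷ visited p

    times : ∀ {u v} → TemporalWalk lab u v → List ℕ
    times [ e ]   = time e ∷ []
    times (e ∷ p) = time e ∷ times p

    firstTime : ∀ {u v} → TemporalWalk lab u v → ℕ
    firstTime [ e ]   = time e
    firstTime (e ∷ _) = time e

    lastTime : ∀ {u v} → TemporalWalk lab u v → ℕ
    lastTime [ e ]   = time e
    lastTime (_ ∷ p) = lastTime p

  record TemporalPath (lab : Labeling) (u v : Vertex) : Set where
    field
      walk       : TemporalWalk lab u v
      distinct   : Unique (visited walk)
      increasing : Linked _<_ (times walk)

    duration : ℕ
    duration = lastTime walk + 1 ∸ firstTime walk

  open TemporalPath public using (duration)

  IsFastest : ∀ {lab u v} → TemporalPath lab u v → Set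
  IsFastest {lab} {u} {v} p = ∀ (q : TemporalPath lab u v) → duration p ≤ duration q

-- ∞ is the adjoined top element of ℕ ⁺; `fin` embeds ℕ.
record DiTTR (Δ k : ℕ) : Set where
  field
    tree   : SimpleGraph
    isTree : IsTree tree

  graph : Digraph
  graph = bidirected tree

  open Digraph graph public
  open Temporal graph Δ public

  field
    D          : Vertex → Vertex → ℕ ⁺
    D-positive : ∀ u v → fin 1 ≤⁺ D u v
    D-bound    : ∀ u v → u ≢ v → ∀ d → IsDistance u v d → fin (d + k) ≤⁺ D u v

  Valid : Labeling → Set
  Valid lab = ∀ u v → u ≢ v →
    Σ[ p ∈ TemporalPath lab u v ] IsFastest p × fin (duration p) ≤⁺ D u v

  Realizable : Set
  Realizable = Σ[ lab ∈ Labeling ] Valid lab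

  EnforcesEqual : ∀ {u v} → Edge u v → Edge v u → Set
  EnforcesEqual {u} {v} uv vu = ∀ lab → Valid lab → lab u v uv ≡ lab v u vu

{-# OPTIONS --safe #-}
module Submission where

-- On the path between two vertices of a tree, let the delay be the duration of
-- the fastest temporal path minus its number of edges.  Since Δ is even,
-- K = Δ - 3 is odd and at least k, so delays up to K may be prescribed.  The
-- gadget is a comb: a long spine with a leaf at every spine vertex.  The
-- labeling to be enforced increases by one from each spine edge to the next, in
-- both directions; D allows every pair the larger of K and its delay under that
-- labeling.
--
-- Consider a valid labeling and a stretch of the spine free of delays.  The
-- offset θ between the two spine labels entering a vertex grows by 2 (mod Δ)
-- per vertex, and the waiting times lo and hi for reaching the leaf there from
-- the left and from the right satisfy hi ≡ lo + θ (mod Δ).  Once hi ≥ θ, the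
-- bound K on the delay between neighbouring leaves forces hi ≥ θ at the next
-- vertex too (entering and leaving the leaf in alternation), until θ exceeds K,
-- which is absurd.  Over Δ - 2 vertices this
-- leaves θ = 3 as the only possible start, whence both labels of the middle
-- edge agree; moreover the first leaf of the stretch then uses up the whole
-- delay K, so the spine before it is free of delays as well.  As the spine has
-- total delay at most K in either direction and consists of 2K + 1 blocks of
-- Δ edges, some block is free of delays, hence so is the first one.

open import Defs
open import Data.Bool using (Bool; true; false; not)
open import Data.Bool.Properties using (T?; T-irrelevant; not-involutive)
open import Data.Empty using (⊥-elim)
open import Data.Fin using (Fin; toℕ; fromℕ<; splitAt; join)
open import Data.Fin.Properties using (toℕ<n; toℕ-injective; toℕ-fromℕ<; splitAt-join; join-splitAt) renaming (_≟_ to _≟ᶠ_)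
open import Data.List.Membership.Propositional using (_∈_)
open import Data.List using (_∷_)
open import Data.List.Relation.Unary.All as All using (All; []; _∷_)
open import Data.List.Relation.Unary.AllPairs using ([]; _∷_)
open import Data.List.Relation.Unary.Any using (here; there)
open import Data.List.Relation.Unary.Linked using (Linked; [-]; _∷_)
open import Data.List.Relation.Unary.Unique.Propositional using (Unique)
open import Data.Nat
open import Data.Nat.DivMod
open import Data.Nat.Divisibility using (_∣_; divides)
open import Data.Nat.Properties
open import Data.Nat.Tactic.RingSolver using (solve-∀)
open import Data.Product using (∃; ∃-syntax; Σ-syntax; _×_; _,_; proj₁; proj₂)
open import Data.Sum using (_⊎_; inj₁; inj₂; [_,_]′) renaming (map to map-⊎)
open import Function using (_∘_)
open import Relation.Binary.Construct.Add.Supremum.NonStrict _≤_ using ([_]; [≤]-injective)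
open import Relation.Binary.Construct.Closure.ReflexiveTransitive using (ε; _◅_)
open import Relation.Binary.Construct.Closure.Transitive using ([_]; _∷_)
open import Relation.Binary.Definitions using (tri<; tri≈; tri>)
open import Relation.Binary.PropositionalEquality hiding ([_])
open import Relation.Nullary using (¬_; Dec; yes; no; contradiction)
open import Relation.Nullary.Construct.Add.Supremum using () renaming ([_] to fin)
open import Relation.Nullary.Decidable using (⌊_⌋; toWitness; fromWitness)

-- Waiting times modulo Δ.

module Waiting (Δ : ℕ) where

  -- The residue of l - p - 1 modulo Δ: the number of idle time steps between
  -- traversing an edge of label p and the next activation of an edge of label l.
  opaque
    wait : ℕ → ℕ → ℕ
    wait p l with p <? l
    ... | yes _ = l ∸ suc p
    ... | no  _ = l + Δ ∸ suc p

    wait-< : ∀ {p l} → p < l → wait p l ≡ l ∸ suc p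
    wait-< {p} {l} p<l with p <? l
    ... | yes _  = refl
    ... | no p≮l = contradiction p<l p≮l

    wait-≥ : ∀ {p l} → l ≤ p → wait p l ≡ l + Δ ∸ suc p
    wait-≥ {p} {l} l≤p with p <? l
    ... | yes p<l = contradiction p<l (≤⇒≯ l≤p)
    ... | no _    = refl

  -- The defining equation of `wait` without truncated subtraction: the next activation lies in the
  -- same period or in the following one.
  data WaitSpec (p l w : ℕ) : Set where
    within : p < l → suc (p + w) ≡ l     → WaitSpec p l w
    wraps  : l ≤ p → suc (p + w) ≡ l + Δ → WaitSpec p l w

  wait-spec : ∀ {p l} → p < Δ → WaitSpec p l (wait p l)
  wait-spec {p} {l} p<Δ with p <? l
  ... | yes p<l = within p<l (trans (cong (λ w → suc (p + w)) (wait-< p<l)) (m+[n∸m]≡n p<l))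
  ... | no  p≮l = wraps l≤p (trans (cong (λ w → suc (p + w)) (wait-≥ l≤p)) (m+[n∸m]≡n (≤-trans p<Δ (m≤n+m Δ l))))
    where
    l≤p : l ≤ p
    l≤p = ≮⇒≥ p≮l

  wait<Δ : ∀ {p l} → p < Δ → l < Δ → wait p l < Δ
  wait<Δ {p} {l} p<Δ l<Δ with wait p l | wait-spec {p} {l} p<Δ
  ... | w | within _ refl = ≤-<-trans (m≤n+m w p) (<-trans (n<1+n _) l<Δ)
  ... | w | wraps l≤p eq  = +-cancelˡ-≤ p _ _ (begin
    p + suc w   ≡⟨ +-suc p w ⟩
    suc (p + w) ≡⟨ eq ⟩
    l + Δ       ≤⟨ +-monoˡ-≤ Δ l≤p ⟩
    p + Δ       ∎)
    where open ≤-Reasoning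

  wait-succ : ∀ {p} → wait p (suc p) ≡ 0
  wait-succ {p} = trans (wait-< (n<1+n p)) (n∸n≡0 p)

  private
    rotate : ∀ p w x → suc (p + x + w) ≡ suc (p + w) + x
    rotate = solve-∀

  wait-active : ∀ {p l} j → p < Δ → ∃[ i ] suc (p + j * Δ + wait p l) ≡ l + i * Δ
  wait-active {p} {l} j p<Δ with wait p l | wait-spec {p} {l} p<Δ
  ... | w | within _ eq = j , trans (rotate p w (j * Δ)) (cong (_+ j * Δ) eq)
  ... | w | wraps _ eq  = suc j , trans (rotate p w (j * Δ)) (trans (cong (_+ j * Δ) eq) (+-assoc l Δ (j * Δ)))

  -- An activation after time `p + j * Δ` lies in period j or later if p < l, and in a period after
  -- j otherwise; `wait` reaches the first of these.
  wait-earliest : ∀ {p l} j i → p < Δ → l < Δ → p + j * Δ < l + i * Δ →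
                  suc (p + j * Δ + wait p l) ≤ l + i * Δ
  wait-earliest {p} {l} j i p<Δ l<Δ lt with wait p l | wait-spec {p} {l} p<Δ
  ... | w | within _ eq = begin
    suc (p + j * Δ + w) ≡⟨ rotate p w (j * Δ) ⟩
    suc (p + w) + j * Δ ≡⟨ cong (_+ j * Δ) eq ⟩
    l + j * Δ           ≤⟨ +-monoʳ-≤ l (*-monoˡ-≤ Δ (≮⇒≥ i≮j)) ⟩
    l + i * Δ           ∎
    where
    open ≤-Reasoning
    i≮j : ¬ i < j
    i≮j i<j = <⇒≱ lt (begin
      l + i * Δ ≤⟨ +-monoˡ-≤ (i * Δ) (<⇒≤ l<Δ) ⟩
      suc i * Δ ≤⟨ *-monoˡ-≤ Δ i<j ⟩
      j * Δ     ≤⟨ m≤n+m (j * Δ) p ⟩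
      p + j * Δ ∎)
  ... | w | wraps l≤p eq = begin
    suc (p + j * Δ + w) ≡⟨ rotate p w (j * Δ) ⟩
    suc (p + w) + j * Δ ≡⟨ cong (_+ j * Δ) eq ⟩
    l + Δ + j * Δ       ≡⟨ +-assoc l Δ (j * Δ) ⟩
    l + suc j * Δ       ≤⟨ +-monoʳ-≤ l (*-monoˡ-≤ Δ (≰⇒> i≰j)) ⟩
    l + i * Δ           ∎
    where
    open ≤-Reasoning
    i≰j : ¬ i ≤ j
    i≰j i≤j = <⇒≱ lt (+-mono-≤ l≤p (*-monoˡ-≤ Δ i≤j))

  private
    wait-lift : ∀ {p l} → p < Δ → ∃[ e ] suc (p + wait p l) ≡ l + e * Δ
    wait-lift {p} {l} p<Δ with wait p l | wait-spec {p} {l} p<Δ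
    ... | w | within _ eq = 0 , trans eq (sym (+-identityʳ l))
    ... | w | wraps  _ eq = 1 , trans eq (cong (l +_) (sym (+-identityʳ Δ)))

  module _ .{{_ : NonZero Δ}} where

    residue : ∀ {t} q → t < Δ → (t + q * Δ) % Δ ≡ t
    residue {t} q t<Δ = trans ([m+kn]%n≡m%n t q Δ) (m<n⇒m%n≡m t<Δ)

    -- Below 2Δ the quotient by Δ is 0 or 1, so reducing modulo Δ removes at most one Δ.
    below-2Δ : ∀ {x y} m n → x < Δ + Δ → y < Δ → x + m * Δ ≡ y + n * Δ → x ≡ y ⊎ x ≡ y + Δ
    below-2Δ {x} {y} m n x<2Δ y<Δ eq with x <? Δ
    ... | yes x<Δ = inj₁ (trans (sym (residue m x<Δ)) (trans (cong (_% Δ) eq) (residue n y<Δ)))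
    ... | no  x≮Δ = inj₂ (begin
      x                          ≡⟨ x∸Δ+Δ≡x ⟨
      x ∸ Δ + Δ                  ≡⟨ cong (_+ Δ) (residue (suc m) x∸Δ<Δ) ⟨
      (x ∸ Δ + suc m * Δ) % Δ + Δ  ≡⟨ cong (λ t → t % Δ + Δ) (+-assoc (x ∸ Δ) Δ (m * Δ)) ⟨
      (x ∸ Δ + Δ + m * Δ) % Δ + Δ  ≡⟨ cong (λ t → (t + m * Δ) % Δ + Δ) x∸Δ+Δ≡x ⟩
      (x + m * Δ) % Δ + Δ        ≡⟨ cong (λ t → t % Δ + Δ) eq ⟩
      (y + n * Δ) % Δ + Δ        ≡⟨ cong (_+ Δ) (residue n y<Δ) ⟩
      y + Δ                      ∎)
      where
      open ≡-Reasoning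
      x∸Δ+Δ≡x : x ∸ Δ + Δ ≡ x
      x∸Δ+Δ≡x = m∸n+n≡m (≮⇒≥ x≮Δ)
      x∸Δ<Δ : x ∸ Δ < Δ
      x∸Δ<Δ = +-cancelʳ-< Δ _ _ (subst (_< Δ + Δ) (sym x∸Δ+Δ≡x) x<2Δ)

    -- As residues, (b - a - 1) + (c - b - 1) + 1 = c - a - 1, and the left side is below 2Δ.
    wait-compose : ∀ {a b c} → a < Δ → b < Δ → c < Δ →
                   suc (wait a b + wait b c) ≡ wait a c ⊎ suc (wait a b + wait b c) ≡ wait a c + Δ
    wait-compose {a} {b} {c} a<Δ b<Δ c<Δ
      with wait-lift {a} {b} a<Δ | wait-lift {b} {c} b<Δ | wait-lift {a} {c} a<Δ
    ... | e₁ , eq₁ | e₂ , eq₂ | e₃ , eq₃ =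
      below-2Δ e₃ (e₁ + e₂) (+-mono-≤-< (wait<Δ a<Δ b<Δ) (wait<Δ b<Δ c<Δ)) (wait<Δ a<Δ c<Δ)
        -- Adding `suc a + b` on both sides lets the three lifts be substituted without subtraction.
        (+-cancelˡ-≡ (suc a + b) _ _ (begin
          suc a + b + (suc (w₁ + w₂) + e₃ * Δ)             ≡⟨ lemma₁ a b w₁ w₂ (e₃ * Δ) ⟩
          suc (a + w₁) + suc (b + w₂) + e₃ * Δ             ≡⟨ cong₂ (λ s t → s + t + e₃ * Δ) eq₁ eq₂ ⟩
          (b + e₁ * Δ) + (c + e₂ * Δ) + e₃ * Δ             ≡⟨ lemma₂ b c e₁ e₂ e₃ Δ ⟩
          b + (c + e₃ * Δ) + (e₁ + e₂) * Δ                 ≡⟨ cong (λ s → b + s + (e₁ + e₂) * Δ) (sym eq₃) ⟩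
          b + suc (a + w₃) + (e₁ + e₂) * Δ                 ≡⟨ lemma₃ a b w₃ ((e₁ + e₂) * Δ) ⟩
          suc a + b + (w₃ + (e₁ + e₂) * Δ)                 ∎))
      where
      open ≡-Reasoning
      w₁ = wait a b
      w₂ = wait b c
      w₃ = wait a c
      lemma₁ : ∀ a b w₁ w₂ x → suc a + b + (suc (w₁ + w₂) + x) ≡ suc (a + w₁) + suc (b + w₂) + x
      lemma₁ = solve-∀
      lemma₂ : ∀ b c e₁ e₂ e₃ d → (b + e₁ * d) + (c + e₂ * d) + e₃ * d ≡ b + (c + e₃ * d) + (e₁ + e₂) * d
      lemma₂ = solve-∀
      lemma₃ : ∀ a b w x → b + suc (a + w) + x ≡ suc a + b + (w + x)
      lemma₃ = solve-∀

    wait-compose-0ˡ : ∀ {a b c} → a < Δ → b < Δ → c < Δ → wait a b ≡ 0 →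
                      suc (wait b c) ≡ wait a c ⊎ suc (wait b c) ≡ wait a c + Δ
    wait-compose-0ˡ {a} {b} {c} a<Δ b<Δ c<Δ z =
      subst (λ w → suc (w + wait b c) ≡ wait a c ⊎ suc (w + wait b c) ≡ wait a c + Δ) z (wait-compose a<Δ b<Δ c<Δ)

    wait-compose-0ʳ : ∀ {a b c} → a < Δ → b < Δ → c < Δ → wait b c ≡ 0 →
                      suc (wait a b) ≡ wait a c ⊎ suc (wait a b) ≡ wait a c + Δ
    wait-compose-0ʳ {a} {b} {c} a<Δ b<Δ c<Δ z =
      subst (λ w → suc w ≡ wait a c ⊎ suc w ≡ wait a c + Δ) (trans (cong (wait a b +_) z) (+-identityʳ (wait a b)))
        (wait-compose a<Δ b<Δ c<Δ)

    wait-injectiveʳ : ∀ {a b c} → a < Δ → b < Δ → c < Δ → wait a b ≡ wait a c → b ≡ c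
    wait-injectiveʳ {a} {b} {c} a<Δ b<Δ c<Δ eq with wait-lift {a} {b} a<Δ | wait-lift {a} {c} a<Δ
    ... | e₁ , eq₁ | e₂ , eq₂ = begin
      b                  ≡⟨ residue e₁ b<Δ ⟨
      (b + e₁ * Δ) % Δ   ≡⟨ cong (_% Δ) (trans (sym eq₁) (trans (cong (λ w → suc (a + w)) eq) eq₂)) ⟩
      (c + e₂ * Δ) % Δ   ≡⟨ residue e₂ c<Δ ⟩
      c                  ∎
      where open ≡-Reasoning

-- Unique paths in a tree.

-- The neighbour of u in the direction of v.  That every other neighbour leads
-- away from v, with u as the only way back, is what makes paths unique.
record Guide (G : Digraph) : Set where
  open Digraph G
  field
    next   : Vertex → Vertex → Vertex
    detour : ∀ {u v y} → u ≢ v → Edge u y → y ≢ next u v → y ≢ v × next y v ≡ u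

module Guided {G : Digraph} (guide : Guide G) where
  open Digraph G
  open Guide guide

  -- Every step is dictated by `next`, so a route is determined by its endpoints.
  data Route (v : Vertex) : Vertex → ℕ → Set where
    stop : Route v v 0
    go   : ∀ {u y n} → u ≢ v → Edge u y → y ≡ next u v → Route v y n → Route v u (suc n)

  route-length : ∀ {u v m n} → Route v u m → Route v u n → m ≡ n
  route-length stop            stop             = refl
  route-length stop            (go u≢v _ _ _)   = contradiction refl u≢v
  route-length (go u≢v _ _ _)  stop             = contradiction refl u≢v
  route-length (go _ _ refl r) (go _ _ refl r′) = cong suc (route-length r r′)

  walk-of : ∀ {u v n} → Route v u n → Walk u v
  walk-of stop         = ε
  walk-of (go _ e _ r) = e ◅ walk-of r

  end∈vertices : ∀ {u v} (w : Walk u v) → v ∈ vertices w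
  end∈vertices ε       = here refl
  end∈vertices (_ ◅ w) = there (end∈vertices w)

  start∈vertices : ∀ {u v} (w : Walk u v) → u ∈ vertices w
  start∈vertices ε       = here refl
  start∈vertices (_ ◅ _) = here refl

  -- Since u has been visited, the path cannot step back to it; any other step is a detour again, so
  -- v is never reached.
  path-never-strays : ∀ {u v y} (w : Walk y v) → y ≢ v → next y v ≡ u →
                      All (u ≢_) (vertices w) → ¬ IsPath w
  path-never-strays ε       y≢v _    _         _            = y≢v refl
  path-never-strays (e ◅ w) y≢v refl (_ ∷ u∉w) (y∉w ∷ path) =
    let y′≢v , back = detour y≢v e (λ y′≡u → All.lookup u∉w (start∈vertices w) (sym y′≡u))
    in path-never-strays w y′≢v back y∉w path

  path-follows : ∀ {u v y} (e : Edge u y) (w : Walk y v) → IsPath (e ◅ w) → y ≡ next u v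
  path-follows {u} {v} {y} e w (u∉w ∷ path) with y ≟ᶠ next u v
  ... | yes y≡next = y≡next
  ... | no  y≢next =
    let y≢v , back = detour (All.lookup u∉w (end∈vertices w)) e y≢next
    in contradiction path (path-never-strays w y≢v back u∉w)

  path-length : ∀ {u v n} (w : Walk u v) → IsPath w → Route v u n → length w ≡ n
  path-length ε       _               stop           = refl
  path-length ε       _               (go u≢v _ _ _) = contradiction refl u≢v
  path-length (_ ◅ w) (u∉w ∷ _)       stop           = contradiction refl (All.lookup u∉w (end∈vertices w))
  path-length (e ◅ w) path@(_ ∷ tail) (go _ _ eq r) with trans eq (sym (path-follows e w path))
  ... | refl = cong suc (path-length w tail r)

  -- All paths between two vertices have the length of the route, but the closing edge, reversed, is
  -- a path of length 1.
  acyclic : (∀ {u v} → Edge v u → Edge u v) → (∀ u v → ∃ (Route v u)) →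
            ∀ {u v} (w : Walk u v) → IsPath w → 2 ≤ length w → ¬ Edge v u
  acyclic reverse route {u} {v} w@(_ ◅ w′) path@(u∉w′ ∷ _) 2≤|w| e = <-irrefl |uv|≡|w| 2≤|w|
    where
    u≢v : u ≢ v
    u≢v = All.lookup u∉w′ (end∈vertices w′)
    |uv|≡|w| : 1 ≡ length w
    |uv|≡|w| = let r = proj₂ (route u v) in
      trans (path-length (reverse e ◅ ε) ((u≢v ∷ []) ∷ [] ∷ []) r) (sym (path-length w path r))

  -- Durations of temporal paths.

  module Timing (Δ : ℕ) where
    open Temporal G Δ
    open Waiting Δ
    open TimeEdge

    -- p is the label of the edge by which the start of the route was entered.
    delay : (Vertex → Vertex → ℕ) → ℕ → ∀ {u v n} → Route v u n → ℕ
    delay L p stop                 = 0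
    delay L p (go {u} {y} _ _ _ r) = wait p (L u y) + delay L (L u y) r

    -- No waiting precedes the first edge, because the duration starts at its activation.
    routeDelay : (Vertex → Vertex → ℕ) → ∀ {u v n} → Route v u n → ℕ
    routeDelay L stop                 = 0
    routeDelay L (go {u} {y} _ _ _ r) = delay L (L u y) r

    delay-unique : ∀ L p {u v m n} (r : Route v u m) (r′ : Route v u n) → delay L p r ≡ delay L p r′
    delay-unique L p stop                stop             = refl
    delay-unique L p stop                (go u≢v _ _ _)   = contradiction refl u≢v
    delay-unique L p (go u≢v _ _ _)      stop             = contradiction refl u≢v
    delay-unique L p (go {u} _ _ refl r) (go _ _ refl r′) = cong (wait p (L u (next u _)) +_) (delay-unique L _ r r′)

    routeDelay-unique : ∀ L {u v m n} (r : Route v u m) (r′ : Route v u n) → routeDelay L r ≡ routeDelay L r′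
    routeDelay-unique L stop            stop             = refl
    routeDelay-unique L stop            (go u≢v _ _ _)   = contradiction refl u≢v
    routeDelay-unique L (go u≢v _ _ _)  stop             = contradiction refl u≢v
    routeDelay-unique L (go _ _ refl r) (go _ _ refl r′) = delay-unique L _ r r′

    module _ (lab : Labeling) where

      -- Non-edges get the junk label 0.
      label : Vertex → Vertex → ℕ
      label u v with T? (Digraph.arc G u v)
      ... | yes e = toℕ (lab u v e)
      ... | no  _ = 0

      label-edge : ∀ {u v} (e : Edge u v) → label u v ≡ toℕ (lab u v e)
      label-edge {u} {v} e with T? (Digraph.arc G u v)
      ... | yes e′ = cong (λ e → toℕ (lab u v e)) (T-irrelevant e′ e)
      ... | no ¬e  = contradiction e ¬e

      label<Δ : ∀ {u v} → Edge u v → label u v < Δ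
      label<Δ {u} {v} e = subst (_< Δ) (sym (label-edge e)) (toℕ<n (lab u v e))

      label-bounded : .{{NonZero Δ}} → ∀ u v → label u v < Δ
      label-bounded u v with T? (Digraph.arc G u v)
      ... | yes e = toℕ<n (lab u v e)
      ... | no  _ = >-nonZero⁻¹ Δ

      time-label : ∀ {u v} (te : TimeEdge lab u v) → ∃[ i ] time te ≡ label u v + i * Δ
      time-label te = let i , eq = active te in i , trans eq (cong (_+ i * Δ) (sym (label-edge (edge te))))

      static : ∀ {u v} → TemporalWalk lab u v → Walk u v
      static [ te ]   = edge te ◅ ε
      static (te ∷ p) = edge te ◅ static p

      vertices-static : ∀ {u v} (p : TemporalWalk lab u v) → vertices (static p) ≡ visited p
      vertices-static [ _ ]   = refl
      vertices-static (_ ∷ p) = cong (_ ∷_) (vertices-static p)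

      static-isPath : ∀ {u v} (p : TemporalWalk lab u v) → Unique (visited p) → IsPath (static p)
      static-isPath p = subst Unique (sym (vertices-static p))

      first≤last : ∀ {u v} (p : TemporalWalk lab u v) → Linked _<_ (times p) → firstTime p ≤ lastTime p
      first≤last [ _ ]           _            = ≤-refl
      first≤last (_ ∷ [ _ ])     (t<t′ ∷ _)   = <⇒≤ t<t′
      first≤last (_ ∷ p@(_ ∷ _)) (t<t′ ∷ inc) = ≤-trans (<⇒≤ t<t′) (first≤last p inc)

      times-head : ∀ {u v t} (p : TemporalWalk lab u v) → Linked _<_ (t ∷ times p) → t < firstTime p × Linked _<_ (times p)
      times-head [ _ ]   (t< ∷ inc) = t< , inc
      times-head (_ ∷ _) (t< ∷ inc) = t< , inc

      -- The path has to follow the route, and by `wait-earliest` no edge can be used sooner than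
      -- `wait` allows after its predecessor. Here `l + j * Δ` is the time of the edge by which u
      -- was entered.
      arrival-≥ : ∀ {u v n l j} (p : TemporalWalk lab u v) → Unique (visited p) →
                  Linked _<_ (l + j * Δ ∷ times p) → l < Δ → (r : Route v u n) →
                  l + j * Δ + (delay label l r + n) ≤ lastTime p
      arrival-≥ p _ inc _ stop = let t< , inc′ = times-head p inc in
        subst (_≤ lastTime p) (sym (+-identityʳ _)) (≤-trans (<⇒≤ t<) (first≤last p inc′))
      arrival-≥ {u} {v} {l = l} {j} [ te ] uniq (t< ∷ _) l<Δ (go u≢v _ eq r)
        with trans eq (sym (path-follows (edge te) ε (static-isPath [ te ] uniq))) | time-label te
      ... | refl | i , t≡ with r
      ... | go v≢v _ _ _ = contradiction refl v≢v
      ... | stop = begin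
        l + j * Δ + (wait l (label u v) + 0 + 1) ≡⟨ cong (λ s → l + j * Δ + (s + 1)) (+-identityʳ (wait l (label u v))) ⟩
        l + j * Δ + (wait l (label u v) + 1)     ≡⟨ +-assoc (l + j * Δ) (wait l (label u v)) 1 ⟨
        l + j * Δ + wait l (label u v) + 1       ≡⟨ +-comm _ 1 ⟩
        suc (l + j * Δ + wait l (label u v))     ≤⟨ wait-earliest j i l<Δ (label<Δ (edge te)) (subst (l + j * Δ <_) t≡ t<) ⟩
        label u v + i * Δ                        ≡⟨ t≡ ⟨
        time te                                  ∎
        where open ≤-Reasoning
      arrival-≥ {u} {v} {l = l} {j} (te ∷ p) uniq@(_ ∷ uniq′) (t< ∷ inc) l<Δ (go {n = n} u≢v _ eq r)
        with trans eq (sym (path-follows (edge te) (static p) (static-isPath (te ∷ p) uniq))) | time-label te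
      ... | refl | i , t≡ = begin
        l + j * Δ + (wait l l′ + rest + suc n)       ≡⟨ cong (l + j * Δ +_) (trans (+-suc _ n) (cong suc (+-assoc (wait l l′) rest n))) ⟩
        l + j * Δ + suc (wait l l′ + (rest + n))     ≡⟨ +-suc (l + j * Δ) _ ⟩
        suc (l + j * Δ + (wait l l′ + (rest + n)))   ≡⟨ cong suc (+-assoc (l + j * Δ) (wait l l′) (rest + n)) ⟨
        suc (l + j * Δ + wait l l′) + (rest + n)     ≤⟨ +-monoˡ-≤ (rest + n) (wait-earliest j i l<Δ l′<Δ (subst (l + j * Δ <_) t≡ t<)) ⟩
        l′ + i * Δ + (rest + n)                      ≤⟨ arrival-≥ {j = i} p uniq′ (subst (λ t → Linked _<_ (t ∷ times p)) t≡ inc) l′<Δ r ⟩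
        lastTime p                                   ∎
        where
        open ≤-Reasoning
        l′ = label u _
        l′<Δ = label<Δ (edge te)
        rest = delay label l′ r

      duration-≥ : ∀ {u v n} → u ≢ v → (r : Route v u n) (p : TemporalPath lab u v) →
                   routeDelay label r + n ≤ duration p
      duration-≥ u≢v stop _ = contradiction refl u≢v
      duration-≥ {u} {v} _ (go {n = n} u≢v _ eq r) record { walk = [ te ] ; distinct = uniq }
        with trans eq (sym (path-follows (edge te) ε (static-isPath [ te ] uniq)))
      ... | refl with r
      ... | go v≢v _ _ _ = contradiction refl v≢v
      ... | stop = ≤-reflexive (sym (m+n∸m≡n (time te) 1))
      duration-≥ {u} {v} _ (go {n = n} u≢v _ eq r) record { walk = te ∷ p ; distinct = uniq@(_ ∷ uniq′) ; increasing = inc }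
        with trans eq (sym (path-follows (edge te) (static p) (static-isPath (te ∷ p) uniq))) | time-label te
      ... | refl | i , t≡ = subst (_≤ lastTime p + 1 ∸ time te) (m+n∸m≡n (time te) _) (∸-monoˡ-≤ (time te) (begin
        time te + (delay label l′ r + suc n)      ≡⟨ cong (time te +_) (trans (+-suc _ n) (+-comm 1 _)) ⟩
        time te + (delay label l′ r + n + 1)      ≡⟨ +-assoc (time te) _ 1 ⟨
        time te + (delay label l′ r + n) + 1      ≡⟨ cong (λ t → t + (delay label l′ r + n) + 1) t≡ ⟩
        l′ + i * Δ + (delay label l′ r + n) + 1   ≤⟨ +-monoˡ-≤ 1 (arrival-≥ {j = i} p uniq′ (subst (λ t → Linked _<_ (t ∷ times p)) t≡ inc) (label<Δ (edge te)) r) ⟩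
        lastTime p + 1                            ∎))
        where
        open ≤-Reasoning
        l′ = label u _

      -- The walk that, after time `l + j * Δ`, takes each edge as early as possible. The bound on
      -- distances to v in `closer` keeps the vertices distinct when a farther one is prepended.
      record Greedy {u v n} (r : Route v u n) (l j : ℕ) : Set where
        field
          walk    : TemporalWalk lab u v
          arrival : lastTime walk ≡ l + j * Δ + (delay label l r + n)
          linked  : Linked _<_ (l + j * Δ ∷ times walk)
          unique  : Unique (visited walk)
          closer  : All (λ x → ∃[ m ] m ≤ n × Route v x m) (visited walk)

      farther : ∀ {u v n} → Route v u (suc n) → ∀ {xs} →
                All (λ x → ∃[ m ] m ≤ n × Route v x m) xs → All (u ≢_) xs
      farther r = All.map λ where
        (m , m≤n , r′) refl → <-irrefl (route-length r′ r) (s≤s m≤n)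

      weaken : ∀ {v n xs} → All (λ x → ∃[ m ] m ≤ n × Route v x m) xs →
               All (λ x → ∃[ m ] m ≤ suc n × Route v x m) xs
      weaken = All.map λ (m , m≤n , r) → m , m≤n⇒m≤1+n m≤n , r

      greedy : ∀ {u v n l} j → l < Δ → (r : Route v u (suc n)) → Greedy r l j
      greedy {u} {v} {l = l} j l<Δ r@(go {y = y} u≢v e eq r′)
        with wait-active {l} {label u y} j l<Δ
      ... | i , t≡ with r′
      ... | stop = record
        { walk    = [ te ]
        ; arrival = trans (sym t≡) (trans (sym (+-suc (l + j * Δ) _)) (cong (l + j * Δ +_) (trans (+-comm 1 _) (cong (_+ 1) (sym (+-identityʳ _))))))
        ; linked  = subst (l + j * Δ <_) t≡ (s≤s (m≤m+n (l + j * Δ) _)) ∷ [-]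
        ; unique  = (u≢v ∷ []) ∷ [] ∷ []
        ; closer  = (_ , ≤-refl , r) ∷ (_ , z≤n , stop) ∷ []
        }
        where
        te : TimeEdge lab u y
        te = record { edge = e ; time = label u y + i * Δ ; active = i , cong (_+ i * Δ) (label-edge e) }
      ... | r″@(go {n = n} _ _ _ _) = record
        { walk    = te ∷ G.walk
        ; arrival = begin
            lastTime G.walk                            ≡⟨ G.arrival ⟩
            l′ + i * Δ + (rest + suc n)                ≡⟨ cong (_+ (rest + suc n)) t≡ ⟨
            suc (l + j * Δ + wait l l′) + (rest + suc n) ≡⟨ cong suc (+-assoc (l + j * Δ) (wait l l′) (rest + suc n)) ⟩
            suc (l + j * Δ + (wait l l′ + (rest + suc n))) ≡⟨ +-suc (l + j * Δ) _ ⟨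
            l + j * Δ + suc (wait l l′ + (rest + suc n)) ≡⟨ cong (l + j * Δ +_) (trans (+-suc _ (suc n)) (cong suc (+-assoc (wait l l′) rest (suc n)))) ⟨
            l + j * Δ + (wait l l′ + rest + suc (suc n)) ∎
        ; linked  = subst (l + j * Δ <_) t≡ (s≤s (m≤m+n (l + j * Δ) _)) ∷ G.linked
        ; unique  = farther r G.closer ∷ G.unique
        ; closer  = (_ , ≤-refl , r) ∷ weaken G.closer
        }
        where
        open ≡-Reasoning
        l′ = label u y
        rest = delay label l′ r″
        te : TimeEdge lab u y
        te = record { edge = e ; time = l′ + i * Δ ; active = i , cong (_+ i * Δ) (label-edge e) }
        module G = Greedy (greedy i (label<Δ e) r″)

      -- Attains the lower bound `duration-≥`: the first edge is used in its first period, all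
      -- others greedily.
      fastest : ∀ {u v n} → u ≢ v → (r : Route v u n) →
                Σ[ p ∈ TemporalPath lab u v ] duration p ≡ routeDelay label r + n
      fastest u≢v stop = contradiction refl u≢v
      fastest {u} {v} u≢v (go {y = y} _ e _ stop) = record
        { walk = [ record { edge = e ; time = toℕ (lab u v e) ; active = 0 , sym (+-identityʳ _) } ]
        ; distinct = (u≢v ∷ []) ∷ [] ∷ [] ; increasing = [-] } , m+n∸m≡n (toℕ (lab u v e)) 1
      fastest {u} {v} u≢v r@(go {y = y} _ e _ r′@(go {n = n} _ _ _ _)) = record
        -- The time is written `l + 0` to match the starting time `l + 0 * Δ` of `greedy`.
        { walk = record { edge = e ; time = l + 0 ; active = 0 , cong (_+ 0) (label-edge e) } ∷ G.walk
        ; distinct = farther r G.closer ∷ G.unique ; increasing = G.linked } ,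
        trans (cong (λ t → t + 1 ∸ (l + 0)) G.arrival)
          (trans (cong (_∸ (l + 0)) (+-assoc (l + 0) _ 1))
            (trans (m+n∸m≡n (l + 0) _) (trans (+-comm _ 1) (sym (+-suc (delay label l r′) (suc n))))))
        where
        l = label u y
        module G = Greedy (greedy 0 (label<Δ e) r′)

-- The comb: adjacency, routes and the tree property.

data Spot : Set where
  spine leaf : ℕ → Spot

pos : Spot → ℕ
pos (spine i) = i
pos (leaf i)  = i

data Adj : Spot → Spot → Set where
  right    : ∀ {i} → Adj (spine i) (spine (suc i))
  left     : ∀ {i} → Adj (spine (suc i)) (spine i)
  toLeaf   : ∀ {i} → Adj (spine i) (leaf i)
  fromLeaf : ∀ {i} → Adj (leaf i) (spine i)

adj? : ∀ a b → Dec (Adj a b)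
adj? (spine i) (spine j) with suc i ≟ j | suc j ≟ i
... | yes refl | _        = yes right
... | no  _    | yes refl = yes left
... | no  i≢j  | no j≢i   = no λ where
  right → i≢j refl
  left  → j≢i refl
adj? (spine i) (leaf j) with i ≟ j
... | yes refl = yes toLeaf
... | no  i≢j  = no λ where toLeaf → i≢j refl
adj? (leaf i) (spine j) with i ≟ j
... | yes refl = yes fromLeaf
... | no  i≢j  = no λ where fromLeaf → i≢j refl
adj? (leaf _) (leaf _) = no λ ()

adj-sym : ∀ {a b} → Adj a b → Adj b a
adj-sym right    = left
adj-sym left     = right
adj-sym toLeaf   = fromLeaf
adj-sym fromLeaf = toLeaf

adj-irrefl : ∀ {a} → ¬ Adj a a
adj-irrefl ()

-- The neighbour of the first spot towards the second, in a comb unbounded to the right; junk if the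
-- two spots are equal.
step : Spot → Spot → Spot
step (leaf i)  b = spine i
step (spine i) b with <-cmp i (pos b)
... | tri< _ _ _ = spine (suc i)
... | tri≈ _ _ _ = b
... | tri> _ _ _ = spine (pred i)

step-< : ∀ {i b} → i < pos b → step (spine i) b ≡ spine (suc i)
step-< {i} {b} i<b with <-cmp i (pos b)
... | tri< _ _ _   = refl
... | tri≈ i≮b _ _ = contradiction i<b i≮b
... | tri> i≮b _ _ = contradiction i<b i≮b

step-> : ∀ {i b} → pos b < i → step (spine i) b ≡ spine (pred i)
step-> {i} {b} b<i with <-cmp i (pos b)
... | tri< _ _ b≮i = contradiction b<i b≮i
... | tri≈ _ _ b≮i = contradiction b<i b≮i
... | tri> _ _ _   = refl

step-at : ∀ b → step (spine (pos b)) b ≡ b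
step-at b with <-cmp (pos b) (pos b)
... | tri< b<b _ _ = contradiction b<b (n≮n _)
... | tri≈ _ _ _   = refl
... | tri> _ _ b<b = contradiction b<b (n≮n _)

-- A leaf has a single neighbour and offers no detour. From a spine vertex, a detour leads into a
-- leaf or along the spine away from b, and the first step back undoes it.
step-detour : ∀ {a b c} → a ≢ b → Adj a c → c ≢ step a b → c ≢ b × step c b ≡ a
step-detour {leaf i} _ fromLeaf c≢ = contradiction refl c≢
step-detour {spine i} {b} a≢b toLeaf c≢ = (λ where refl → c≢ (sym (step-at b))) , refl
step-detour {spine i} {b} a≢b right c≢ with <-cmp i (pos b)
... | tri< _ _ _    = contradiction refl c≢
... | tri≈ _ eq _   = (λ where refl → 1+n≢n (sym eq)) , step-> {suc i} {b} (s≤s (≤-reflexive (sym eq)))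
... | tri> _ _ b<i  = (λ where refl → 1+n≰n (<⇒≤ b<i)) , step-> {suc i} {b} (m<n⇒m<1+n b<i)
step-detour {spine (suc i)} {b} a≢b left c≢ with <-cmp (suc i) (pos b)
... | tri> _ _ _   = contradiction refl c≢
... | tri≈ _ eq _  = (λ where refl → 1+n≢n eq) , step-< {i} {b} (≤-reflexive eq)
... | tri< lt _ _  = (λ where refl → 1+n≰n (<⇒≤ lt)) , step-< {i} {b} (<⇒≤ lt)

module Comb (top : ℕ) where

  size : ℕ
  size = suc top

  clamp : ℕ → Fin size
  clamp i = fromℕ< (s≤s (m⊓n≤n i top))

  toℕ-clamp : ∀ {i} → i ≤ top → toℕ (clamp i) ≡ i
  toℕ-clamp {i} i≤ = trans (toℕ-fromℕ< (s≤s (m⊓n≤n i top))) (m≤n⇒m⊓n≡m i≤)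

  -- Positions beyond the end of the spine are mapped to its last vertex.
  opaque
    at : Spot → Fin (size + size)
    at (spine i) = join size size (inj₁ (clamp i))
    at (leaf i)  = join size size (inj₂ (clamp i))

    spot : Fin (size + size) → Spot
    spot u = [ spine ∘ toℕ , leaf ∘ toℕ ]′ (splitAt size u)

    spot-at : ∀ a → pos a ≤ top → spot (at a) ≡ a
    spot-at (spine i) i≤ = trans (cong [ _ , _ ]′ (splitAt-join size size (inj₁ (clamp i)))) (cong spine (toℕ-clamp i≤))
    spot-at (leaf i)  i≤ = trans (cong [ _ , _ ]′ (splitAt-join size size (inj₂ (clamp i)))) (cong leaf (toℕ-clamp i≤))

    pos-spot : ∀ u → pos (spot u) ≤ top
    pos-spot u with splitAt size u
    ... | inj₁ i = s≤s⁻¹ (toℕ<n i)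
    ... | inj₂ i = s≤s⁻¹ (toℕ<n i)

    at-spot : ∀ u → at (spot u) ≡ u
    at-spot u = trans (lemma (splitAt size u)) (join-splitAt size size u)
      where
      clamp-toℕ : ∀ i → clamp (toℕ i) ≡ i
      clamp-toℕ i = toℕ-injective (toℕ-clamp (s≤s⁻¹ (toℕ<n i)))
      lemma : ∀ x → at ([ spine ∘ toℕ , leaf ∘ toℕ ]′ x) ≡ join size size x
      lemma (inj₁ i) = cong (join size size ∘ inj₁) (clamp-toℕ i)
      lemma (inj₂ i) = cong (join size size ∘ inj₂) (clamp-toℕ i)

  comb : SimpleGraph
  comb = record
    { order       = size + size
    ; adj         = λ u v → ⌊ adj? (spot u) (spot v) ⌋
    ; symmetric   = λ u v → fromWitness ∘ adj-sym ∘ toWitness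
    ; irreflexive = λ u → adj-irrefl ∘ toWitness
    }

  open Digraph (bidirected comb)

  adjacent : ∀ {a b} → pos a ≤ top → pos b ≤ top → Adj a b → Edge (at a) (at b)
  adjacent {a} {b} a≤ b≤ ab = fromWitness (subst₂ Adj (sym (spot-at a a≤)) (sym (spot-at b b≤)) ab)

  spot-≢ : ∀ {u v} → u ≢ v → spot u ≢ spot v
  spot-≢ {u} {v} u≢v eq = u≢v (trans (sym (at-spot u)) (trans (cong at eq) (at-spot v)))

  guide : Guide (bidirected comb)
  guide = record
    { next   = λ u v → at (step (spot u) (spot v))
    ; detour = λ {u} {v} {y} u≢v e y≢ →
        let c≢b , back = step-detour (spot-≢ u≢v) (toWitness e) (λ eq → y≢ (trans (sym (at-spot y)) (cong at eq)))
        in (λ y≡v → c≢b (cong spot y≡v)) , trans (cong at back) (at-spot u)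
    }

  open Guided guide public

  go-step : ∀ {a b c n} → pos a ≤ top → pos b ≤ top → pos c ≤ top → a ≢ b → Adj a c → step a b ≡ c →
            Route (at b) (at c) n → Route (at b) (at a) (suc n)
  go-step {a} {b} {c} a≤ b≤ c≤ a≢b ac eq = go
    (λ e → a≢b (trans (sym (spot-at a a≤)) (trans (cong spot e) (spot-at b b≤))))
    (adjacent a≤ c≤ ac)
    (cong at (sym (trans (cong₂ step (spot-at a a≤) (spot-at b b≤)) eq)))

  -- The distance of a spot from the spine.
  leafness : Spot → ℕ
  leafness (spine _) = 0
  leafness (leaf _) = 1

  arrive : ∀ b → pos b ≤ top → Route (at b) (at (spine (pos b))) (leafness b)
  arrive (spine i) _  = stop
  arrive (leaf i) i≤ = go-step i≤ i≤ i≤ (λ ()) toLeaf (step-at (leaf i)) stop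

  up : ∀ m i b → pos b ≡ m + i → pos b ≤ top → Route (at b) (at (spine i)) (m + leafness b)
  up zero    i b refl b≤ = arrive b b≤
  up (suc m) i b eq   b≤ = go-step (<⇒≤ i<top) b≤ i<top (λ where refl → n≮n _ i<b) right (step-< i<b)
    (up m (suc i) b (trans eq (sym (+-suc m i))) b≤)
    where
    i<b : i < pos b
    i<b = subst (i <_) (sym eq) (s≤s (m≤n+m i m))
    i<top : i < top
    i<top = ≤-trans i<b b≤

  down : ∀ m b → m + pos b ≤ top → Route (at b) (at (spine (m + pos b))) (m + leafness b)
  down zero    b b≤ = arrive b b≤
  down (suc m) b le = go-step le (≤-trans (m≤n+m _ (suc m)) le) (<⇒≤ le) (λ eq → <⇒≢ b<a (sym (cong pos eq))) left (step-> {b = b} b<a)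
    (down m b (<⇒≤ le))
    where
    b<a : pos b < suc m + pos b
    b<a = s≤s (m≤n+m (pos b) m)

  leave : ∀ {i b n} → i ≤ top → pos b ≤ top → leaf i ≢ b → Route (at b) (at (spine i)) n → Route (at b) (at (leaf i)) (suc n)
  leave i≤ b≤ i≢b = go-step i≤ b≤ i≤ i≢b fromLeaf refl

  spotRoute : ∀ a b → pos a ≤ top → pos b ≤ top → ∃ (Route (at b) (at a))
  spotRoute (spine i) b i≤ b≤ with ≤-total i (pos b)
  ... | inj₁ i≤b = _ , up (pos b ∸ i) i b (sym (m∸n+n≡m i≤b)) b≤
  ... | inj₂ b≤i = subst (λ j → ∃ (Route (at b) (at (spine j)))) (m∸n+n≡m b≤i)
                     (_ , down (i ∸ pos b) b (subst (_≤ top) (sym (m∸n+n≡m b≤i)) i≤))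
  spotRoute (leaf i) (spine j) i≤ b≤ = let n , r = spotRoute (spine i) (spine j) i≤ b≤ in suc n , leave i≤ b≤ (λ ()) r
  spotRoute (leaf i) (leaf j) i≤ b≤ with i ≟ j
  ... | yes refl = 0 , stop
  ... | no  i≢j  = let n , r = spotRoute (spine i) (leaf j) i≤ b≤ in suc n , leave i≤ b≤ (λ where refl → i≢j refl) r

  route : ∀ u v → ∃ (Route v u)
  route u v = subst₂ (λ x y → ∃ (Route y x)) (at-spot u) (at-spot v) (spotRoute (spot u) (spot v) (pos-spot u) (pos-spot v))

  isTree : IsTree comb
  isTree = record
    { nonempty  = at (spine 0)
    ; connected = λ u v → walk-of (proj₂ (route u v))
    ; acyclic   = acyclic (λ {u} {v} → SimpleGraph.symmetric comb v u) route
    }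

-- Partial sums and a pigeonhole argument.

sum : (ℕ → ℕ) → ℕ → ℕ → ℕ
sum a i zero    = 0
sum a i (suc m) = a i + sum a (suc i) m

sum-+ : ∀ a i m n → sum a i (m + n) ≡ sum a i m + sum a (m + i) n
sum-+ a i zero    n = refl
sum-+ a i (suc m) n = begin
  a i + sum a (suc i) (m + n)                     ≡⟨ cong (a i +_) (sum-+ a (suc i) m n) ⟩
  a i + (sum a (suc i) m + sum a (m + suc i) n)   ≡⟨ +-assoc (a i) _ _ ⟨
  a i + sum a (suc i) m + sum a (m + suc i) n     ≡⟨ cong (λ j → a i + sum a (suc i) m + sum a j n) (+-suc m i) ⟩
  a i + sum a (suc i) m + sum a (suc m + i) n     ∎
  where open ≡-Reasoning

sum≡0⇒all≡0 : ∀ a i m → sum a i m ≡ 0 → ∀ {j} → j < m → a (j + i) ≡ 0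
sum≡0⇒all≡0 a i (suc m) eq {zero}  _   = m+n≡0⇒m≡0 (a i) eq
sum≡0⇒all≡0 a i (suc m) eq {suc j} j<m =
  subst (λ n → a n ≡ 0) (+-suc j i) (sum≡0⇒all≡0 a (suc i) m (m+n≡0⇒n≡0 (a i) eq) (s≤s⁻¹ j<m))

sum-snoc : ∀ a i m → sum a i (suc m) ≡ a (m + i) + sum a i m
sum-snoc a i zero    = refl
sum-snoc a i (suc m) = begin
  a i + sum a (suc i) (suc m)                 ≡⟨ cong (a i +_) (sum-snoc a (suc i) m) ⟩
  a i + (a (m + suc i) + sum a (suc i) m)     ≡⟨ +-assoc (a i) _ _ ⟨
  a i + a (m + suc i) + sum a (suc i) m       ≡⟨ cong (_+ sum a (suc i) m) (+-comm (a i) _) ⟩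
  a (m + suc i) + a i + sum a (suc i) m       ≡⟨ +-assoc (a (m + suc i)) _ _ ⟩
  a (m + suc i) + (a i + sum a (suc i) m)     ≡⟨ cong (λ j → a j + sum a i (suc m)) (+-suc m i) ⟩
  a (suc m + i) + sum a i (suc m)             ∎
  where open ≡-Reasoning

all≡0⇒sum≡0 : ∀ a i m → (∀ j → a j ≡ 0) → sum a i m ≡ 0
all≡0⇒sum≡0 a i zero    z = refl
all≡0⇒sum≡0 a i (suc m) z = cong₂ _+_ (z i) (all≡0⇒sum≡0 a (suc i) m z)

-- If every increment before M were positive, h would reach M.
flat-step : ∀ (h d : ℕ → ℕ) → (∀ q → h (suc q) ≡ h q + d q) →
            ∀ M → h M < M → ∃[ q ] q < M × d q ≡ 0
flat-step h d hs (suc M) h<M with d M in eq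
... | zero  = M , ≤-refl , eq
... | suc x = let q , q<M , z = flat-step h d hs M (s≤s⁻¹ (begin-strict
                    suc (h M)           ≤⟨ s≤s (m≤m+n (h M) x) ⟩
                    suc (h M + x)       ≡⟨ +-suc (h M) x ⟨
                    h M + suc x         ≡⟨ cong (h M +_) eq ⟨
                    h M + d M           ≡⟨ hs M ⟨
                    h (suc M)           <⟨ h<M ⟩
                    suc M               ∎))
              in q , m<n⇒m<1+n q<M , z
  where open ≤-Reasoning

-- Offsets and waiting times on a delay-free stretch.

module Gadget (ρ : ℕ) where

  -- Every even Δ from 4 on has this form, with ρ = Δ/2 - 2.
  K Δ : ℕ
  K = 1 + ρ * 2
  Δ = 3 + K

  -- The waiting times around the vertices m = 0, …, K of a delay-free stretch:
  -- with `true` those for entering the leaf from the left (lo) and from the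
  -- right (hi), with `false` those for leaving it to the left (lo) and to the
  -- right (hi).
  record Window : Set where
    field
      lo hi   : Bool → ℕ → ℕ
      θ       : ℕ → ℕ
      θ-lower : ∀ m → 1 ≤ θ m
      θ-upper : ∀ m → θ m ≤ Δ
      θ-step  : ∀ {m} → m < K → θ (suc m) ≡ 2 + θ m ⊎ θ (suc m) + Δ ≡ 2 + θ m
      turn    : ∀ b {m} → m ≤ K → hi b m ≡ lo b m + θ m ⊎ hi b m + Δ ≡ lo b m + θ m
      meet    : ∀ b {m} → m ≤ K → hi (not b) m + lo b (suc m) ≤ K
      first   : ∀ b → lo b 0 ≤ K

    K-bound : ∀ {x y} → x ≤ K → ¬ y + Δ ≤ 2 + x
    K-bound {x} {y} x≤K le = <⇒≱ (n<1+n (2 + K)) (≤-trans (m≤n+m Δ y) (≤-trans le (s≤s (s≤s x≤K))))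

    lo≤K : ∀ b {m} → m ≤ K → lo b m ≤ K
    lo≤K b {zero}  _   = first b
    lo≤K b {suc m} m<K = ≤-trans (m≤n+m _ _) (meet b (<⇒≤ m<K))

    hi≤K : ∀ b {m} → m ≤ K → hi b m ≤ K
    hi≤K b {m} m≤K = subst (λ c → hi c m ≤ K) (not-involutive b) (≤-trans (m≤m+n _ _) (meet (not b) m≤K))

    -- Offsets are at least 1, so a wrap would require 2 + θ m > Δ.
    θ-step-below : ∀ {m} → m < K → 2 + θ m ≤ Δ → θ (suc m) ≡ 2 + θ m
    θ-step-below {m} m<K 2+θ≤Δ with θ-step m<K
    ... | inj₁ eq = eq
    ... | inj₂ eq = contradiction 2+θ≤Δ (<⇒≱ (subst (Δ <_) eq (+-monoˡ-≤ Δ (θ-lower (suc m)))))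

    θ-advance : ∀ d {m} → d + m ≤ K → θ m + d * 2 ≤ Δ → θ (d + m) ≡ θ m + d * 2
    θ-advance zero    {m} _    _  = sym (+-identityʳ (θ m))
    θ-advance (suc d) {m} d+m< le = trans (θ-step-below d+m< (subst (_≤ Δ) eq le)) (sym eq)
      where
      shift : ∀ t x → t + (2 + x) ≡ 2 + (t + x)
      shift = solve-∀
      le′ : θ m + d * 2 ≤ Δ
      le′ = ≤-trans (+-monoʳ-≤ (θ m) (m≤n+m (d * 2) 2)) le
      eq : θ m + suc d * 2 ≡ 2 + θ (d + m)
      eq = trans (shift (θ m) (d * 2)) (cong (2 +_) (sym (θ-advance d (<⇒≤ d+m<) le′)))

    -- Otherwise the turn wraps, and `hi b (suc m) + Δ` is at most 2 plus the delay of a hop between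
    -- neighbouring leaves, thus at most K + 2 < Δ. The hop leaves one leaf and enters the other,
    -- hence the `not`.
    climb : ∀ b {m} → m < K → 2 + θ m ≤ Δ → θ m ≤ hi (not b) m → θ (suc m) ≤ hi b (suc m)
    climb b {m} m<K 2+θ≤Δ θ≤hi with turn b m<K
    ... | inj₁ eq = subst (θ (suc m) ≤_) (sym eq) (m≤n+m _ _)
    ... | inj₂ eq = ⊥-elim (K-bound {y = hi b (suc m)} (meet b (<⇒≤ m<K)) (begin
      hi b (suc m) + Δ                       ≡⟨ eq ⟩
      lo b (suc m) + θ (suc m)               ≡⟨ cong (lo b (suc m) +_) (θ-step-below m<K 2+θ≤Δ) ⟩
      lo b (suc m) + (2 + θ m)               ≤⟨ +-monoʳ-≤ (lo b (suc m)) (+-monoʳ-≤ 2 θ≤hi) ⟩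
      lo b (suc m) + (2 + hi (not b) m)      ≡⟨ shuffle (lo b (suc m)) (hi (not b) m) ⟩
      2 + (hi (not b) m + lo b (suc m))      ∎))
      where
      open ≤-Reasoning
      shuffle : ∀ x y → x + (2 + y) ≡ 2 + (y + x)
      shuffle = solve-∀

    -- By `climb`, hi ≥ θ persists while θ grows by 2 per vertex without passing Δ; after d vertices
    -- θ > K contradicts hi ≤ K.
    no-overrun : ∀ d {m} b → d + m ≤ K → θ m ≤ hi b m → θ m + d * 2 ≤ Δ → ¬ K < θ m + d * 2
    no-overrun zero    {m} b m≤K θ≤hi _ K<θ =
      <⇒≱ (subst (K <_) (+-identityʳ (θ m)) K<θ) (≤-trans θ≤hi (hi≤K b m≤K))
    no-overrun (suc d) {m} b d+m< θ≤hi le K<θ =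
      no-overrun d {suc m} (not b) (subst (_≤ K) (sym (+-suc d m)) d+m<)
        (climb (not b) m<K 2+θ≤Δ (subst (λ c → θ m ≤ hi c m) (sym (not-involutive b)) θ≤hi))
        (subst (_≤ Δ) eq le) (subst (K <_) eq K<θ)
      where
      shift : ∀ t x → t + (2 + x) ≡ 2 + t + x
      shift = solve-∀
      m<K : m < K
      m<K = ≤-trans (s≤s (m≤n+m m d)) d+m<
      2+θ≤Δ : 2 + θ m ≤ Δ
      2+θ≤Δ = ≤-trans (m≤m+n (2 + θ m) (d * 2)) (subst (_≤ Δ) (shift (θ m) (d * 2)) le)
      eq : θ m + suc d * 2 ≡ θ (suc m) + d * 2
      eq = trans (shift (θ m) (d * 2)) (cong (_+ d * 2) (sym (θ-step-below m<K 2+θ≤Δ)))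

    -- A turn that wraps would need lo ≥ Δ - 2 = K + 1.
    small-turn : ∀ {m} → m ≤ K → θ m ≤ 2 → ∀ b → θ m ≤ hi b m
    small-turn {m} m≤K θ≤2 b with turn b m≤K
    ... | inj₁ eq = subst (θ m ≤_) (sym eq) (m≤n+m _ _)
    ... | inj₂ eq = ⊥-elim (K-bound {y = hi b m} (lo≤K b m≤K) (begin
      hi b m + Δ     ≡⟨ eq ⟩
      lo b m + θ m   ≤⟨ +-monoʳ-≤ (lo b m) θ≤2 ⟩
      lo b m + 2     ≡⟨ +-comm (lo b m) 2 ⟩
      2 + lo b m     ∎))
      where open ≤-Reasoning

    private
      ρ+ρ : ∀ n → n + suc n ≡ 1 + n * 2
      ρ+ρ = solve-∀

      ρ+suc≤K : ∀ {m} → m ≤ suc ρ → ρ + m ≤ K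
      ρ+suc≤K {m} m≤ = subst (ρ + m ≤_) (ρ+ρ ρ) (+-monoʳ-≤ ρ m≤)

    -- From 1, ρ + 1 steps lead to K + 2, an overrun.
    θ≢1 : ∀ {m} → m ≤ ρ → θ m ≢ 1
    θ≢1 {m} m≤ρ θ≡1 = no-overrun (suc ρ) {m} true le (small-turn (≤-trans (m≤n+m m (suc ρ)) le) (subst (_≤ 2) (sym θ≡1) (s≤s z≤n)) true)
      (subst (λ t → t + suc ρ * 2 ≤ Δ) (sym θ≡1) (n≤1+n _)) (subst (λ t → K < t + suc ρ * 2) (sym θ≡1) (n≤1+n _))
      where
      le : suc ρ + m ≤ K
      le = subst (_≤ K) (+-suc ρ m) (ρ+suc≤K (s≤s m≤ρ))

    -- From 2, ρ steps lead to K + 1, an overrun.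
    θ≢2 : ∀ {m} → m ≤ suc ρ → θ m ≢ 2
    θ≢2 {m} m≤ θ≡2 = no-overrun ρ {m} true le (small-turn (≤-trans (m≤n+m m ρ) le) (≤-reflexive θ≡2) true)
      (subst (λ t → t + ρ * 2 ≤ Δ) (sym θ≡2) (m≤n+m _ 2)) (subst (λ t → K < t + ρ * 2) (sym θ≡2) ≤-refl)
      where
      le : ρ + m ≤ K
      le = ρ+suc≤K m≤

    θ-wrap : ∀ {m t} → m < K → 2 + θ m ≡ t + Δ → 1 ≤ t → θ (suc m) ≡ t
    θ-wrap {m} {t} m<K eq 1≤t with θ-step m<K
    ... | inj₁ eq′ = contradiction (θ-upper (suc m)) (<⇒≱ (subst (Δ <_) (sym (trans eq′ eq)) (+-monoˡ-≤ Δ 1≤t)))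
    ... | inj₂ eq′ = +-cancelʳ-≡ Δ _ _ (trans eq′ eq)

    private
      halve : ∀ n → (∃[ s ] n ≡ s * 2) ⊎ (∃[ s ] n ≡ 1 + s * 2)
      halve zero = inj₁ (0 , refl)
      halve (suc n) with halve n
      ... | inj₁ (s , refl) = inj₂ (s , refl)
      ... | inj₂ (s , refl) = inj₁ (suc s , refl)

      ρ≤K : ρ ≤ K
      ρ≤K = subst (_≤ K) (+-identityʳ ρ) (ρ+suc≤K z≤n)

      ρ<K : ρ < K
      ρ<K = subst (_≤ K) (+-comm ρ 1) (ρ+suc≤K (s≤s z≤n))

    θ-reach : ∀ d {u t} → θ 0 ≡ u → d ≤ ρ → u + d * 2 ≤ Δ → 2 + (u + d * 2) ≡ t + Δ → 1 ≤ t → θ (suc d) ≡ t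
    θ-reach d refl d≤ρ le eq 1≤t = θ-wrap (≤-<-trans d≤ρ ρ<K) (trans (cong (2 +_) θd) eq) 1≤t
      where
      θd : θ d ≡ θ 0 + d * 2
      θd = trans (cong θ (sym (+-identityʳ d))) (θ-advance d (subst (_≤ K) (sym (+-identityʳ d)) (≤-trans d≤ρ ρ≤K)) le)

    -- Starting at 1 or 2 is excluded at once. An odd start from 5 on climbs to Δ - 1 and wraps to
    -- 1, an even one from 4 on climbs to Δ and wraps to 2, both early enough for `θ≢1` and `θ≢2` to
    -- apply.
    θ-first : θ 0 ≡ 3
    θ-first with θ 0 in eq | θ-lower 0 | θ-upper 0
    ... | suc t | _ | t<Δ with halve t
    ... | inj₁ (0 , refl) = contradiction eq (θ≢1 z≤n)
    ... | inj₁ (1 , refl) = refl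
    ... | inj₁ (suc (suc s) , refl) = contradiction
      (θ-reach d eq (m∸n≤m ρ (suc s)) (≤-trans (n≤1+n _) (≤-reflexive top)) (cong suc top) ≤-refl)
      (θ≢1 (∸-monoʳ-< {ρ} {suc s} {0} z<s s<ρ))
      where
      s<ρ : s < ρ
      s<ρ = *-cancelʳ-< 2 s ρ (s≤s⁻¹ (s≤s⁻¹ (s≤s⁻¹ (s≤s⁻¹ t<Δ))))
      -- The number of steps from 5 + 2s up to Δ - 1.
      d = ρ ∸ suc s
      doubled : ∀ x y → 1 + (5 + x * 2 + y * 2) ≡ 4 + (suc x + y) * 2
      doubled = solve-∀
      top : 1 + (5 + s * 2 + d * 2) ≡ Δ
      top = trans (doubled s d) (cong (λ n → 4 + n * 2) (m+[n∸m]≡n s<ρ))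
    ... | inj₂ (0 , refl) = contradiction eq (θ≢2 z≤n)
    ... | inj₂ (suc s , refl) = contradiction
      (θ-reach d eq (m∸n≤m ρ s) (≤-reflexive top) (cong (2 +_) top) (s≤s z≤n))
      (θ≢2 (s≤s (m∸n≤m ρ s)))
      where
      s≤ρ : s ≤ ρ
      s≤ρ = *-cancelʳ-≤ s ρ 2 (s≤s⁻¹ (s≤s⁻¹ (s≤s⁻¹ (s≤s⁻¹ t<Δ))))
      -- The number of steps from 4 + 2s up to Δ.
      d = ρ ∸ s
      doubled : ∀ x y → 4 + x * 2 + y * 2 ≡ 4 + (x + y) * 2
      doubled = solve-∀
      top : 4 + s * 2 + d * 2 ≡ Δ
      top = trans (doubled s d) (cong (λ n → 4 + n * 2) (m+[n∸m]≡n s≤ρ))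

    -- From 3, ρ steps lead to Δ - 1; the next one wraps to 1.
    θ-middle : θ (suc ρ) ≡ 1
    θ-middle = θ-reach ρ θ-first ≤-refl (n≤1+n _) refl ≤-refl

    -- A turn without a wrap would give hi ≥ θ = 3 at the vertex 0, and ρ steps from 3 overrun K.
    -- With the wrap, lo + 3 ≥ Δ.
    lo-first : ∀ b → K ≤ lo b 0
    lo-first b with turn b {0} z≤n
    ... | inj₁ eq = ⊥-elim (no-overrun ρ b (subst (_≤ K) (sym (+-identityʳ ρ)) ρ≤K)
      (subst (θ 0 ≤_) (sym eq) (m≤n+m _ _))
      (subst (λ t → t + ρ * 2 ≤ Δ) (sym θ-first) (n≤1+n _))
      (subst (λ t → K < t + ρ * 2) (sym θ-first) (n≤1+n _)))
    ... | inj₂ eq = +-cancelˡ-≤ 3 _ _ (begin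
      Δ           ≤⟨ m≤n+m Δ (hi b 0) ⟩
      hi b 0 + Δ  ≡⟨ eq ⟩
      lo b 0 + θ 0 ≡⟨ cong (lo b 0 +_) θ-first ⟩
      lo b 0 + 3   ≡⟨ +-comm (lo b 0) 3 ⟩
      3 + lo b 0   ∎)
      where open ≤-Reasoning

  -- Delay bounds on the comb and what they enforce.

  open Waiting Δ

  -- The labels along the comb: of the spine edge from i to i + 1 (f) and back
  -- (g), and of the edges from the leaf i (X) and to it (Y).
  record Labels : Set where
    field
      f g X Y : ℕ → ℕ

    -- The waiting times at the spine vertex `suc i` when moving right (`φ`) and left (`β`).
    φ β : ℕ → ℕ
    φ i = wait (f i) (f (suc i))
    β i = wait (g (suc i)) (g i)

  M N : ℕ
  M = suc (K + K)
  N = M * Δ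

  -- Pairs of vertices: the two ends of the spine, the left end of the spine and
  -- the leaf i + 1, and the leaves i and i + 1.
  data Pair : Set where
    across→ across←    : Pair
    in→ out← hop→ hop← : ℕ → Pair

  pairDelay : Labels → Pair → ℕ
  pairDelay L = λ where
      across→  → sum φ 0 N
      across←  → sum β 0 N
      (in→ i)  → sum φ 0 i + wait (f i) (Y (suc i))
      (out← i) → wait (X (suc i)) (g i) + sum β 0 i
      (hop→ i) → wait (X i) (f i) + wait (f i) (Y (suc i))
      (hop← i) → wait (X (suc i)) (g i) + wait (g i) (Y i)
    where open Labels L

  -- These pairs have delay at most K under the labeling `good`.
  data Critical : Pair → Set where
    across→ : Critical across→
    across← : Critical across←
    in→     : ∀ {q} → q < M → Critical (in→ (q * Δ))
    out←    : ∀ {q} → q < M → Critical (out← (q * Δ))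
    hop→    : ∀ {q m} → q < M → m ≤ K → Critical (hop→ (suc m + q * Δ))
    hop←    : ∀ {q m} → q < M → m ≤ K → Critical (hop← (suc m + q * Δ))

  -- For q = 0 the flat block is the first one; otherwise the first block lies inside the flat
  -- prefix.
  first-flat : ∀ a q → sum a 0 (q * Δ) ≡ 0 → sum a (q * Δ) Δ ≡ 0 → ∀ {j} → j < Δ → a (j + 0) ≡ 0
  first-flat a zero    _ z = sum≡0⇒all≡0 a 0 Δ z
  first-flat a (suc q) z _ j<Δ = sum≡0⇒all≡0 a 0 (suc q * Δ) z (≤-trans j<Δ (m≤m+n Δ (q * Δ)))

  module _ (L : Labels)
           (f<Δ : ∀ i → Labels.f L i < Δ) (g<Δ : ∀ i → Labels.g L i < Δ)
           (X<Δ : ∀ i → Labels.X L i < Δ) (Y<Δ : ∀ i → Labels.Y L i < Δ)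
           (tight : ∀ {p} → Critical p → pairDelay L p ≤ K) where
    open Labels L

    module Flat (q : ℕ) (q<M : q < M)
                (φ≡0 : ∀ {j} → j < Δ → φ (j + q * Δ) ≡ 0) (β≡0 : ∀ {j} → j < Δ → β (j + q * Δ) ≡ 0) where

      o : ℕ
      o = q * Δ

      m<Δ : ∀ {m} → m ≤ K → m < Δ
      m<Δ m≤K = s≤s (≤-trans m≤K (m≤n+m K 2))

      -- The same number θ m - 1 is read off on either side of the vertex m + 1.
      θ-two-ended : ∀ {m} → m ≤ K → wait (g (m + o)) (f (suc m + o)) ≡ wait (g (suc m + o)) (f (m + o))
      θ-two-ended {m} m≤K = match
        (wait-compose-0ˡ (g<Δ (suc m + o)) (g<Δ (m + o)) (f<Δ (m + o)) (β≡0 (m<Δ m≤K)))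
        (wait-compose-0ʳ (g<Δ (m + o)) (f<Δ (m + o)) (f<Δ (suc m + o)) (φ≡0 (m<Δ m≤K)))
        where
        w = wait (g (m + o)) (f (suc m + o))
        w′ = wait (g (suc m + o)) (f (m + o))
        match : ∀ {x} → x ≡ w′ ⊎ x ≡ w′ + Δ → x ≡ w ⊎ x ≡ w + Δ → w ≡ w′
        match (inj₁ e₁) (inj₁ e₂) = trans (sym e₂) e₁
        match (inj₂ e₁) (inj₂ e₂) = +-cancelʳ-≡ Δ _ _ (trans (sym e₂) e₁)
        match (inj₁ e₁) (inj₂ e₂) = contradiction (wait<Δ (g<Δ (suc m + o)) (f<Δ (m + o))) (≤⇒≯ (subst (Δ ≤_) (trans (sym e₂) e₁) (m≤n+m Δ w)))
        match (inj₂ e₁) (inj₁ e₂) = contradiction (wait<Δ (g<Δ (m + o)) (f<Δ (suc m + o))) (≤⇒≯ (subst (Δ ≤_) (trans (sym e₁) e₂) (m≤n+m Δ w′)))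

      -- The difference f - g of the two spine labels entering the vertex `suc m + o`, represented
      -- in 1, ..., Δ.
      θ : ℕ → ℕ
      θ m = suc (wait (g (suc m + o)) (f (m + o)))

      lo hi : Bool → ℕ → ℕ
      lo true  m = wait (f (m + o)) (Y (suc m + o))
      lo false m = wait (X (suc m + o)) (g (m + o))
      hi true  m = wait (g (suc m + o)) (Y (suc m + o))
      hi false m = wait (X (suc m + o)) (f (suc m + o))

      -- Without delays, one vertex further to the right the f label is larger by one and the g
      -- label smaller by one, modulo Δ.
      θ-step : ∀ {m} → m < K → θ (suc m) ≡ 2 + θ m ⊎ θ (suc m) + Δ ≡ 2 + θ m
      θ-step {m} m<K = combine
        (wait-compose-0ˡ (g<Δ (2 + m + o)) (g<Δ (suc m + o)) (f<Δ (m + o)) (β≡0 (m<Δ m<K)))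
        (wait-compose-0ʳ (g<Δ (2 + m + o)) (f<Δ (m + o)) (f<Δ (suc m + o)) (φ≡0 (m<Δ (<⇒≤ m<K))))
        where
        combine : ∀ {v} → θ m ≡ v ⊎ θ m ≡ v + Δ →
                  suc v ≡ wait (g (2 + m + o)) (f (suc m + o)) ⊎ suc v ≡ wait (g (2 + m + o)) (f (suc m + o)) + Δ →
                  θ (suc m) ≡ 2 + θ m ⊎ θ (suc m) + Δ ≡ 2 + θ m
        combine (inj₁ e₁) (inj₁ e₂) = inj₁ (cong suc (trans (sym e₂) (cong suc (sym e₁))))
        combine (inj₁ e₁) (inj₂ e₂) = inj₂ (cong suc (trans (sym e₂) (cong suc (sym e₁))))
        combine (inj₂ e₁) (inj₁ e₂) = inj₂ (cong suc (trans (cong (_+ Δ) (sym e₂)) (cong suc (sym e₁))))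
        -- Two wraps would push `θ m` above Δ.
        combine {v} (inj₂ e₁) (inj₂ e₂) = contradiction (wait<Δ (g<Δ (suc m + o)) (f<Δ (m + o)))
          (<⇒≱ (subst (Δ <_) (sym e₁) (+-monoˡ-≤ Δ 1≤v)))
          where
          1≤v : 1 ≤ v
          1≤v = s≤s⁻¹ (≤-trans (s≤s (s≤s z≤n)) (subst (Δ ≤_) (sym e₂) (m≤n+m Δ _)))

      -- Waiting times compose through the spine label on the left. For leaving the leaf, the offset
      -- arises between the two outgoing spine edges and is the same by `θ-two-ended`.
      turn : ∀ b {m} → m ≤ K → hi b m ≡ lo b m + θ m ⊎ hi b m + Δ ≡ lo b m + θ m
      turn true {m} m≤K = map-⊎ flip flip
        (wait-compose (g<Δ (suc m + o)) (f<Δ (m + o)) (Y<Δ (suc m + o)))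
        where
        flip : ∀ {x} → θ m + lo true m ≡ x → x ≡ lo true m + θ m
        flip e = trans (sym e) (+-comm (θ m) (lo true m))
      turn false {m} m≤K = map-⊎ flip flip
        (wait-compose (X<Δ (suc m + o)) (g<Δ (m + o)) (f<Δ (suc m + o)))
        where
        flip : ∀ {x} → suc (lo false m + wait (g (m + o)) (f (suc m + o))) ≡ x → x ≡ lo false m + θ m
        flip e = trans (sym e) (trans (sym (+-suc (lo false m) _)) (cong (λ w → lo false m + suc w) (θ-two-ended m≤K)))

      window : Window
      window = record
        { lo = lo ; hi = hi ; θ = θ
        ; θ-lower = λ _ → s≤s z≤n
        ; θ-upper = λ m → wait<Δ (g<Δ (suc m + o)) (f<Δ (m + o))
        ; θ-step = θ-step ; turn = turn
        ; meet = λ where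
            true  m≤K → tight (hop→ q<M m≤K)
            false {m} m≤K → subst (_≤ K) (+-comm (lo false (suc m)) (hi true m)) (tight (hop← q<M m≤K))
        ; first = λ where
            true  → ≤-trans (m≤n+m _ _) (tight (in→ q<M))
            false → ≤-trans (m≤m+n _ _) (tight (out← q<M))
        }

      open Window window using (θ-middle; lo-first)

      -- Both labels follow `g (2 + ρ + o)` without waiting: the first because the offset there is
      -- 1, the second because the block is free of delays.
      middle : f (suc ρ + o) ≡ g (suc ρ + o)
      middle = wait-injectiveʳ (g<Δ (2 + ρ + o)) (f<Δ (suc ρ + o)) (g<Δ (suc ρ + o))
        (trans (suc-injective θ-middle) (sym (β≡0 (s≤s (s≤s (≤-trans (m≤m*n ρ 2) (m≤n+m _ 2)))))))

      -- Entering the first leaf of the block already consumes the whole delay K granted from the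
      -- left end of the spine.
      φ-before : sum φ 0 o ≡ 0
      φ-before = n≤0⇒n≡0 (+-cancelʳ-≤ K _ _ (≤-trans (+-monoʳ-≤ (sum φ 0 o) (lo-first true)) (tight (in→ q<M))))

      β-before : sum β 0 o ≡ 0
      β-before = n≤0⇒n≡0 (+-cancelˡ-≤ K _ _ (≤-trans (+-monoˡ-≤ (sum β 0 o) (lo-first false))
        (subst (lo false 0 + sum β 0 o ≤_) (sym (+-identityʳ K)) (tight (out← q<M)))))

    -- Pigeonhole on both directions at once: total delay at most 2K, spread over 2K + 1 blocks.
    flat-window : ∃[ q ] q < M × sum φ (q * Δ) Δ + sum β (q * Δ) Δ ≡ 0
    flat-window = flat-step (λ q → sum φ 0 (q * Δ) + sum β 0 (q * Δ)) _ next-block M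
      (s≤s (+-mono-≤ (tight across→) (tight across←)))
      where
      interchange : ∀ a b c d → (a + b) + (c + d) ≡ (a + c) + (b + d)
      interchange = solve-∀
      block : ∀ a q → sum a 0 (Δ + q * Δ) ≡ sum a 0 (q * Δ) + sum a (q * Δ) Δ
      block a q = trans (cong (sum a 0) (+-comm Δ (q * Δ)))
        (trans (sum-+ a 0 (q * Δ) Δ) (cong (λ i → sum a 0 (q * Δ) + sum a i Δ) (+-identityʳ (q * Δ))))
      next-block : ∀ q → sum φ 0 (suc q * Δ) + sum β 0 (suc q * Δ)
                 ≡ sum φ 0 (q * Δ) + sum β 0 (q * Δ) + (sum φ (q * Δ) Δ + sum β (q * Δ) Δ)
      next-block q = trans (cong₂ _+_ (block φ q) (block β q)) (interchange (sum φ 0 (q * Δ)) _ _ _)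

    central-labels : f (suc ρ) ≡ g (suc ρ)
    central-labels = let q , q<M , z = flat-window in from-flat q q<M z
      where
      from-flat : ∀ q → q < M → sum φ (q * Δ) Δ + sum β (q * Δ) Δ ≡ 0 → f (suc ρ) ≡ g (suc ρ)
      -- The argument is repeated in block 0, so that the edge found does not depend on the
      -- labeling.
      from-flat q q<M z = subst (λ i → f i ≡ g i) (+-identityʳ (suc ρ)) (Flat.middle 0 (s≤s z≤n)
          (first-flat φ q W.φ-before φz) (first-flat β q W.β-before βz))
        where
        φz = m+n≡0⇒m≡0 (sum φ (q * Δ) Δ) z
        βz = m+n≡0⇒n≡0 (sum φ (q * Δ) Δ) z
        module W = Flat q q<M (sum≡0⇒all≡0 φ (q * Δ) Δ φz) (sum≡0⇒all≡0 β (q * Δ) Δ βz)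

-- A labeling that meets the bounds.

module Good (ρ : ℕ) where
  open Gadget ρ
  open Waiting Δ

  -- In each block of Δ spine vertices the edges of a leaf left of the middle edge
  -- are labeled like the spine edges to its left, those of a leaf right of the
  -- middle edge like the spine edges to its right.
  forward backward inward outward : ℕ → ℕ
  forward  i = i % Δ
  backward i = 2 + K ∸ suc i % Δ
  inward  i with i % Δ ≤? suc ρ
  ... | yes _ = forward (pred i)
  ... | no  _ = backward i
  outward i with i % Δ ≤? suc ρ
  ... | yes _ = backward (pred i)
  ... | no  _ = forward i

  forward<Δ : ∀ i → forward i < Δ
  forward<Δ i = m%n<n i Δ

  backward<Δ : ∀ i → backward i < Δ
  backward<Δ i = s≤s (m∸n≤m (2 + K) (suc i % Δ))

  inward<Δ : ∀ i → inward i < Δ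
  inward<Δ i with i % Δ ≤? suc ρ
  ... | yes _ = forward<Δ (pred i)
  ... | no  _ = backward<Δ i

  outward<Δ : ∀ i → outward i < Δ
  outward<Δ i with i % Δ ≤? suc ρ
  ... | yes _ = backward<Δ (pred i)
  ... | no  _ = forward<Δ i

  good : Labels
  good = record { f = forward ; g = backward ; X = inward ; Y = outward }

  open Labels good using (φ; β)

  -- Residues of consecutive numbers; `2 + K` is Δ - 1.
  data Successive : ℕ → ℕ → Set where
    next : ∀ {t} → suc t < Δ → Successive t (suc t)
    wrap : Successive (2 + K) 0

  successive : ∀ i → Successive (i % Δ) (suc i % Δ)
  successive i = subst (Successive (i % Δ)) (sym suc-%) (cases (m≤n⇒m<n∨m≡n (m%n<n i Δ)))
    where
    suc-% : suc i % Δ ≡ suc (i % Δ) % Δ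
    suc-% = trans (cong (λ n → suc n % Δ) (m≡m%n+[m/n]*n i Δ)) ([m+kn]%n≡m%n (suc (i % Δ)) (i / Δ) Δ)
    cases : ∀ {t} → suc t < Δ ⊎ suc t ≡ Δ → Successive t (suc t % Δ)
    cases {t} (inj₁ lt)   = subst (Successive t) (sym (m<n⇒m%n≡m lt)) (next lt)
    cases     (inj₂ refl) = subst (Successive (2 + K)) (sym (n%n≡0 Δ)) wrap

  φ≡0 : ∀ i → φ i ≡ 0
  φ≡0 i with i % Δ | suc i % Δ | successive i
  ... | t | _ | next _ = wait-succ {t}
  ... | _ | _ | wrap   = trans (wait-≥ {2 + K} z≤n) (n∸n≡0 Δ)

  β≡0 : ∀ i → β i ≡ 0
  β≡0 i with suc i % Δ | suc (suc i) % Δ | successive (suc i)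
  ... | t | _ | next lt = trans (cong (wait (1 + K ∸ t)) (+-∸-assoc 1 {1 + K} {t} (s≤s⁻¹ (s≤s⁻¹ lt)))) wait-succ
  ... | _ | _ | wrap    = trans (cong (wait (2 + K)) (n∸n≡0 (2 + K))) (trans (wait-≥ {2 + K} z≤n) (n∸n≡0 Δ))

  wait≤K : ∀ {p l} → p < l → l ≤ 1 + K → wait p l ≤ K
  wait≤K {p} {l} p<l l≤ = subst (_≤ K) (sym (wait-< p<l)) (≤-trans (∸-monoʳ-≤ l (s≤s (z≤n {p}))) (∸-monoˡ-≤ 1 l≤))

  backward-below : ∀ i → i % Δ ≤ 1 + K → backward i ≡ 1 + K ∸ i % Δ
  backward-below i t≤ with i % Δ | suc i % Δ | successive i
  ... | t | _ | next _ = refl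
  ... | _ | _ | wrap   = contradiction t≤ (<⇒≱ ≤-refl)

  private
    double : ∀ n → n + suc n ≡ 1 + n * 2
    double = solve-∀

  -- Left of the middle edge the forward label t is below the backward label K + 1 - t, so the wait
  -- does not wrap.
  forward-backward : ∀ i → i % Δ ≤ ρ → wait (forward i) (backward i) ≤ K
  forward-backward i t≤ρ = subst (λ l → wait (i % Δ) l ≤ K) (sym (backward-below i (≤-trans t≤ρ (≤-trans (m≤m*n ρ 2) (m≤n+m _ 2)))))
    (wait≤K (m+n≤o⇒m≤o∸n (suc (i % Δ)) (s≤s (≤-trans (+-mono-≤ t≤ρ (≤-trans t≤ρ (n≤1+n ρ))) (≤-reflexive (double ρ)))))
            (m∸n≤m (1 + K) (i % Δ)))

  -- Right of the middle edge the order of the two labels is reversed.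
  backward-forward : ∀ i → suc ρ < i % Δ → i % Δ ≤ 1 + K → wait (backward i) (forward i) ≤ K
  backward-forward i ρ<t t≤ = subst (λ p → wait p (i % Δ) ≤ K) (sym (backward-below i t≤))
    (wait≤K (begin-strict
      1 + K ∸ i % Δ     ≤⟨ ∸-monoʳ-≤ (1 + K) ρ<t ⟩
      1 + K ∸ (2 + ρ)   ≡⟨ cong (λ n → suc n ∸ (2 + ρ)) (double ρ) ⟨
      ρ + suc ρ ∸ suc ρ ≡⟨ m+n∸n≡m ρ (suc ρ) ⟩
      ρ                 <⟨ <-trans (n<1+n ρ) ρ<t ⟩
      i % Δ             ∎) t≤)
    where open ≤-Reasoning

  inward-left : ∀ {i} → i % Δ ≤ suc ρ → inward i ≡ forward (pred i)
  inward-left {i} le with i % Δ ≤? suc ρ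
  ... | yes _ = refl
  ... | no ¬p = contradiction le ¬p

  inward-right : ∀ {i} → suc ρ < i % Δ → inward i ≡ backward i
  inward-right {i} lt with i % Δ ≤? suc ρ
  ... | yes p = contradiction p (<⇒≱ lt)
  ... | no _  = refl

  outward-left : ∀ {i} → i % Δ ≤ suc ρ → outward i ≡ backward (pred i)
  outward-left {i} le with i % Δ ≤? suc ρ
  ... | yes _ = refl
  ... | no ¬p = contradiction le ¬p

  outward-right : ∀ {i} → suc ρ < i % Δ → outward i ≡ forward i
  outward-right {i} lt with i % Δ ≤? suc ρ
  ... | yes p = contradiction p (<⇒≱ lt)
  ... | no _  = refl

  -- For two leaves on the same side of the middle edge, one of the two waits is a wait along the
  -- spine, hence 0, and the other is between a forward and a backward label. Across the middle edge
  -- both are spine waits.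
  hop-good : ∀ i → suc i % Δ ≤ 1 + K → suc (suc i) % Δ ≡ suc (suc i % Δ) →
             pairDelay good (hop→ (suc i)) ≤ K × pairDelay good (hop← (suc i)) ≤ K
  hop-good i t≤ eq with <-cmp (suc i % Δ) (suc ρ)
  ... | tri< t<r _ _
    rewrite inward-left {suc i} (<⇒≤ t<r) | outward-left {suc i} (<⇒≤ t<r)
          | inward-left {suc (suc i)} (subst (_≤ suc ρ) (sym eq) t<r)
          | outward-left {suc (suc i)} (subst (_≤ suc ρ) (sym eq) t<r)
          | φ≡0 i | β≡0 i | +-identityʳ (wait (forward (suc i)) (backward (suc i)))
    = both , both
    where both = forward-backward (suc i) (s≤s⁻¹ t<r)
  ... | tri≈ _ t≡r _
    rewrite inward-left {suc i} (≤-reflexive t≡r) | outward-left {suc i} (≤-reflexive t≡r)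
          | inward-right {suc (suc i)} (subst (suc ρ <_) (sym eq) (s≤s (≤-reflexive (sym t≡r))))
          | outward-right {suc (suc i)} (subst (suc ρ <_) (sym eq) (s≤s (≤-reflexive (sym t≡r))))
          | φ≡0 i | β≡0 i | φ≡0 (suc i) | β≡0 (suc i)
    = z≤n , z≤n
  ... | tri> _ _ r<t
    rewrite inward-right {suc i} r<t | outward-right {suc i} r<t
          | inward-right {suc (suc i)} (subst (suc ρ <_) (sym eq) (m<n⇒m<1+n r<t))
          | outward-right {suc (suc i)} (subst (suc ρ <_) (sym eq) (m<n⇒m<1+n r<t))
          | φ≡0 (suc i) | β≡0 (suc i) | +-identityʳ (wait (backward (suc i)) (forward (suc i)))
    = both , both
    where both = backward-forward (suc i) r<t t≤

  hop-tight : ∀ {m} q → m ≤ K → pairDelay good (hop→ (suc m + q * Δ)) ≤ K × pairDelay good (hop← (suc m + q * Δ)) ≤ K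
  hop-tight {m} q m≤K = hop-good (m + q * Δ) (subst (_≤ 1 + K) (sym res) (s≤s m≤K))
    (trans (residue q (s≤s (s≤s (s≤s m≤K)))) (cong suc (sym res)))
    where
    res : (suc m + q * Δ) % Δ ≡ suc m
    res = residue q (s≤s (s≤s (≤-trans m≤K (n≤1+n K))))

  good-tight : ∀ {p} → Critical p → pairDelay good p ≤ K
  good-tight across→ = ≤-trans (≤-reflexive (all≡0⇒sum≡0 φ 0 N φ≡0)) z≤n
  good-tight across← = ≤-trans (≤-reflexive (all≡0⇒sum≡0 β 0 N β≡0)) z≤n
  good-tight (in→ {q} _)
    rewrite all≡0⇒sum≡0 φ 0 (q * Δ) φ≡0 | outward-left {suc (q * Δ)} (subst (_≤ suc ρ) (sym (residue q (s≤s (s≤s z≤n)))) (s≤s z≤n))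
    = forward-backward (q * Δ) (subst (_≤ ρ) (sym (m*n%n≡0 q Δ)) z≤n)
  good-tight (out← {q} _)
    rewrite all≡0⇒sum≡0 β 0 (q * Δ) β≡0 | inward-left {suc (q * Δ)} (subst (_≤ suc ρ) (sym (residue q (s≤s (s≤s z≤n)))) (s≤s z≤n))
          | +-identityʳ (wait (forward (q * Δ)) (backward (q * Δ)))
    = forward-backward (q * Δ) (subst (_≤ ρ) (sym (m*n%n≡0 q Δ)) z≤n)
  good-tight (hop→ {q} _ m≤K) = proj₁ (hop-tight q m≤K)
  good-tight (hop← {q} _ m≤K) = proj₂ (hop-tight q m≤K)

-- The instance: routes of critical pairs, the matrix D, realizability, enforcement.

module Instance (ρ : ℕ) where
  open Gadget ρ
  open Good ρ
  open Waiting Δ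

  top : ℕ
  top = suc N

  open Comb top
  open Digraph (bidirected comb)
  open Temporal (bidirected comb) Δ
  open Timing Δ

  -- L and ℓ agree on the edges of the comb; outside it L only has junk values.
  record Reads (L : Vertex → Vertex → ℕ) (ℓ : Labels) : Set where
    open Labels ℓ
    field
      f-reads : ∀ i → i < top → L (at (spine i)) (at (spine (suc i))) ≡ f i
      g-reads : ∀ i → i < top → L (at (spine (suc i))) (at (spine i)) ≡ g i
      X-reads : ∀ i → i ≤ top → L (at (leaf i)) (at (spine i)) ≡ X i
      Y-reads : ∀ i → i ≤ top → L (at (spine i)) (at (leaf i)) ≡ Y i

  module Delays {L : Vertex → Vertex → ℕ} {ℓ : Labels} (reads : Reads L ℓ) where
    open Labels ℓ
    open Reads reads

    delay-up-spine : ∀ m i {j} (eq : j ≡ m + suc i) (j≤ : j ≤ top) →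
                     delay L (f i) (up m (suc i) (spine j) eq j≤) ≡ sum φ i m
    delay-up-spine zero    i refl j≤ = refl
    delay-up-spine (suc m) i eq   j≤
      rewrite f-reads (suc i) (≤-trans (subst (suc i <_) (sym eq) (s≤s (m≤n+m (suc i) m))) j≤)
      = cong (φ i +_) (delay-up-spine m (suc i) _ j≤)

    delay-up-leaf : ∀ m i {k} (eq : suc k ≡ m + suc i) (k< : k < top) →
                    delay L (f i) (up m (suc i) (leaf (suc k)) eq k<) ≡ sum φ i m + wait (f k) (Y (suc k))
    delay-up-leaf zero    i refl k< rewrite Y-reads (suc i) k< = +-identityʳ _
    delay-up-leaf (suc m) i {k} eq k<
      rewrite f-reads (suc i) (≤-trans (subst (suc i <_) (sym eq) (s≤s (m≤n+m (suc i) m))) k<)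
      = trans (cong (φ i +_) (delay-up-leaf m (suc i) _ k<)) (sym (+-assoc (φ i) _ _))

    delay-down-spine : ∀ m j (le : m + j ≤ top) → delay L (g (m + j)) (down m (spine j) le) ≡ sum β j m
    delay-down-spine zero    j le = refl
    delay-down-spine (suc m) j le rewrite g-reads (m + j) le =
      trans (cong (β (m + j) +_) (delay-down-spine m j (<⇒≤ le))) (sym (sum-snoc β j m))

  index : Pair → ℕ
  index = λ where
    across→  → 0
    across←  → 0
    (in→ i)  → i
    (out← i) → i
    (hop→ i) → i
    (hop← i) → i

  -- `trailDelay` covers all labelings, since the same route is evaluated under the good labeling,
  -- which determines D, and under an arbitrary valid one.
  record Trip (p : Pair) : Set where
    field
      {source target} : Vertex
      {hops}          : ℕ
      trail           : Route target source (suc hops)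
      trailDelay      : ∀ {L ℓ} → Reads L ℓ → routeDelay L trail ≡ pairDelay ℓ p

  trip : ∀ p → index p ≤ N → Trip p
  trip across→ _ = record
    { trail = up (suc N) 0 (spine top) (sym (+-identityʳ top)) ≤-refl
    ; trailDelay = λ {L} R →
        trans (cong (λ l → delay L l (up N 1 (spine top) _ ≤-refl)) (Reads.f-reads R 0 (s≤s z≤n))) (Delays.delay-up-spine R N 0 _ ≤-refl)
    }
  trip across← _ = record
    { trail = down (suc N) (spine 0) le
    ; trailDelay = λ {L} R →
        trans (cong (λ l → delay L l (down N (spine 0) (<⇒≤ le))) (Reads.g-reads R (N + 0) le)) (Delays.delay-down-spine R N 0 (<⇒≤ le))
    }
    where
    le : suc N + 0 ≤ top
    le = ≤-reflexive (+-identityʳ top)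
  trip (in→ i) i≤N = record
    { trail = up (suc i) 0 (leaf (suc i)) (sym (+-identityʳ (suc i))) (s≤s i≤N)
    ; trailDelay = λ {L} R →
        trans (cong (λ l → delay L l (up i 1 (leaf (suc i)) _ (s≤s i≤N))) (Reads.f-reads R 0 (s≤s z≤n))) (Delays.delay-up-leaf R i 0 _ (s≤s i≤N))
    }
  -- The route built by `down` starts at position `suc i + 0`; the substitution removes the 0.
  trip (out← i) i≤N = subst Trip (cong out← (+-identityʳ i)) (record
    { trail = leave le z≤n (λ ()) (down (suc i) (spine 0) le)
    ; trailDelay = λ {L} {ℓ} R → begin
        delay L (L (at (leaf (suc i + 0))) (at (spine (suc i + 0)))) (down (suc i) (spine 0) le)
          ≡⟨ cong (λ l → delay L l (down (suc i) (spine 0) le)) (Reads.X-reads R (suc i + 0) le) ⟩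
        delay L (Labels.X ℓ (suc i + 0)) (down (suc i) (spine 0) le)
          ≡⟨ cong (λ l → wait (Labels.X ℓ (suc i + 0)) l + delay L l (down i (spine 0) (<⇒≤ le))) (Reads.g-reads R (i + 0) le) ⟩
        wait (Labels.X ℓ (suc i + 0)) (Labels.g ℓ (i + 0)) + delay L (Labels.g ℓ (i + 0)) (down i (spine 0) (<⇒≤ le))
          ≡⟨ cong (wait (Labels.X ℓ (suc i + 0)) (Labels.g ℓ (i + 0)) +_) (trans (Delays.delay-down-spine R i 0 (<⇒≤ le)) (cong (sum (Labels.β ℓ) 0) (sym (+-identityʳ i)))) ⟩
        wait (Labels.X ℓ (suc i + 0)) (Labels.g ℓ (i + 0)) + sum (Labels.β ℓ) 0 (i + 0) ∎
    })
    where
    open ≡-Reasoning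
    le : suc i + 0 ≤ top
    le = subst (_≤ top) (sym (+-identityʳ (suc i))) (s≤s i≤N)
  trip (hop→ i) i≤N = record
    { trail = leave i≤ (s≤s i≤N) (λ ()) (up 1 i (leaf (suc i)) refl (s≤s i≤N))
    ; trailDelay = λ {L} R →
        cong₂ _+_ (cong₂ wait (Reads.X-reads R i i≤) (Reads.f-reads R i (s≤s i≤N)))
                  (trans (+-identityʳ _) (cong₂ wait (Reads.f-reads R i (s≤s i≤N)) (Reads.Y-reads R (suc i) (s≤s i≤N))))
    }
    where
    i≤ : i ≤ top
    i≤ = m≤n⇒m≤1+n i≤N
  trip (hop← i) i≤N = record
    { trail = leave (s≤s i≤N) i≤ (λ ()) (down 1 (leaf i) (s≤s i≤N))
    ; trailDelay = λ {L} R →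
        cong₂ _+_ (cong₂ wait (Reads.X-reads R (suc i) (s≤s i≤N)) (Reads.g-reads R i (s≤s i≤N)))
                  (trans (+-identityʳ _) (cong₂ wait (Reads.g-reads R i (s≤s i≤N)) (Reads.Y-reads R i i≤)))
    }
    where
    i≤ : i ≤ top
    i≤ = m≤n⇒m≤1+n i≤N

  critical-index : ∀ {p} → Critical p → index p ≤ N
  critical-index across→            = z≤n
  critical-index across←            = z≤n
  critical-index (in→ q<M)          = *-monoˡ-≤ Δ (<⇒≤ q<M)
  critical-index (out← q<M)         = *-monoˡ-≤ Δ (<⇒≤ q<M)
  critical-index (hop→ {q} q<M m≤K) = ≤-trans (+-monoˡ-≤ (q * Δ) (s≤s (≤-trans m≤K (m≤n+m K 2)))) (*-monoˡ-≤ Δ q<M)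
  critical-index (hop← {q} q<M m≤K) = ≤-trans (+-monoˡ-≤ (q * Δ) (s≤s (≤-trans m≤K (m≤n+m K 2)))) (*-monoˡ-≤ Δ q<M)

  -- Total on all pairs of spots, with junk values on non-adjacent ones.
  spotLabel : Spot → Spot → ℕ
  spotLabel (spine i) (leaf _) = outward i
  spotLabel (leaf i)  _        = inward i
  spotLabel (spine i) (spine j) with i <? j
  ... | yes _ = forward i
  ... | no  _ = backward j

  spotLabel<Δ : ∀ a b → spotLabel a b < Δ
  spotLabel<Δ (spine i) (leaf _) = outward<Δ i
  spotLabel<Δ (leaf i)  _        = inward<Δ i
  spotLabel<Δ (spine i) (spine j) with i <? j
  ... | yes _ = forward<Δ i
  ... | no  _ = backward<Δ j

  spotLabel-right : ∀ i → spotLabel (spine i) (spine (suc i)) ≡ forward i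
  spotLabel-right i with i <? suc i
  ... | yes _ = refl
  ... | no i≮ = contradiction (n<1+n i) i≮

  spotLabel-left : ∀ i → spotLabel (spine (suc i)) (spine i) ≡ backward i
  spotLabel-left i with suc i <? i
  ... | yes lt = contradiction lt (<⇒≯ (n<1+n i))
  ... | no _   = refl

  goodLabeling : Labeling
  goodLabeling u v _ = fromℕ< (spotLabel<Δ (spot u) (spot v))

  label-good : ∀ {a b} → pos a ≤ top → pos b ≤ top → Adj a b → label goodLabeling (at a) (at b) ≡ spotLabel a b
  label-good {a} {b} a≤ b≤ ab = trans (label-edge goodLabeling (adjacent a≤ b≤ ab))
    (trans (toℕ-fromℕ< (spotLabel<Δ (spot (at a)) (spot (at b)))) (cong₂ spotLabel (spot-at a a≤) (spot-at b b≤)))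

  good-reads : Reads (label goodLabeling) good
  good-reads = record
    { f-reads = λ i i< → trans (label-good (<⇒≤ i<) i< right) (spotLabel-right i)
    ; g-reads = λ i i< → trans (label-good i< (<⇒≤ i<) left) (spotLabel-left i)
    ; X-reads = λ i i≤ → label-good i≤ i≤ fromLeaf
    ; Y-reads = λ i i≤ → label-good i≤ i≤ toLeaf
    }

  goodDelay : Vertex → Vertex → ℕ
  goodDelay u v = routeDelay (label goodLabeling) (proj₂ (route u v))

  bound : Vertex → Vertex → ℕ
  bound u v = K ⊔ goodDelay u v + proj₁ (route u v)

  bound-route : ∀ {u v n} (r : Route v u n) → bound u v ≡ K ⊔ routeDelay (label goodLabeling) r + n
  bound-route {u} {v} r = let n , r′ = route u v in
    cong₂ (λ d m → K ⊔ d + m) (routeDelay-unique (label goodLabeling) r′ r) (route-length r′ r)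

  gadget : ∀ {k} → k ≤ K → DiTTR Δ k
  gadget {k} k≤K = record
    { tree       = comb
    ; isTree     = isTree
    ; D          = λ u v → fin (bound u v)
    ; D-positive = λ u v → [ ≤-trans (s≤s z≤n) (≤-trans (m≤m⊔n K (goodDelay u v)) (m≤m+n _ _)) ]
    ; D-bound    = λ where
        u v _ _ ((w , path , refl) , _) → let n , r = route u v in
          [ (begin
            length w + k                            ≡⟨ cong (_+ k) (path-length w path r) ⟩
            n + k                                   ≡⟨ +-comm n k ⟩
            k + n                                   ≤⟨ +-monoˡ-≤ n (≤-trans k≤K (m≤m⊔n K (goodDelay u v))) ⟩
            bound u v                               ∎) ]
    }
    where open ≤-Reasoning

  realizable : ∀ {k} (k≤K : k ≤ K) → DiTTR.Realizable (gadget k≤K)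
  realizable k≤K = goodLabeling , λ u v u≢v →
    let n , r = route u v
        p , |p|≡ = fastest goodLabeling u≢v r
    in p , (λ q → subst (_≤ duration q) (sym |p|≡) (duration-≥ goodLabeling u≢v r q))
         , [ subst (_≤ bound u v) (sym |p|≡) (+-monoˡ-≤ n (m≤n⊔m K (goodDelay u v))) ]

  -- At indices beyond the spine the vertices are clamped; the values stay below Δ.
  labelsOf : Labeling → Labels
  labelsOf lab = record
    { f = λ i → label lab (at (spine i)) (at (spine (suc i)))
    ; g = λ i → label lab (at (spine (suc i))) (at (spine i))
    ; X = λ i → label lab (at (leaf i)) (at (spine i))
    ; Y = λ i → label lab (at (spine i)) (at (leaf i))
    }

  -- A temporal path takes at least the delay of the route plus its length, and D grants a critical
  -- pair exactly K of delay, because the good labeling stays within K there.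
  valid⇒tight : ∀ {k} (k≤K : k ≤ K) lab → DiTTR.Valid (gadget k≤K) lab →
                ∀ {p} → Critical p → pairDelay (labelsOf lab) p ≤ K
  valid⇒tight k≤K lab valid {p} c = conclude trail
    where
    open Trip (trip p (critical-index c))
    conclude : Route target source (suc hops) → pairDelay (labelsOf lab) p ≤ K
    -- The index `suc hops` rules out `stop`, so the endpoints are distinct.
    conclude (go s≢t _ _ _) = let π , _ , |π|≤D = valid source target s≢t in
      +-cancelʳ-≤ (suc hops) _ _ (begin
        pairDelay (labelsOf lab) p + suc hops   ≡⟨ cong (_+ suc hops) (trailDelay reads) ⟨
        routeDelay (label lab) trail + suc hops ≤⟨ duration-≥ lab s≢t trail π ⟩
        duration π                              ≤⟨ [≤]-injective |π|≤D ⟩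
        bound source target                     ≡⟨ bound-route trail ⟩
        K ⊔ routeDelay (label goodLabeling) trail + suc hops ≡⟨ cong (λ d → K ⊔ d + suc hops) (trailDelay good-reads) ⟩
        K ⊔ pairDelay good p + suc hops         ≡⟨ cong (_+ suc hops) (m≥n⇒m⊔n≡m (good-tight c)) ⟩
        K + suc hops                            ∎)
      where
      open ≤-Reasoning
      reads : Reads (label lab) (labelsOf lab)
      reads = record { f-reads = λ _ _ → refl ; g-reads = λ _ _ → refl ; X-reads = λ _ _ → refl ; Y-reads = λ _ _ → refl }

  2+ρ≤top : 2 + ρ ≤ top
  2+ρ≤top = s≤s (≤-trans (s≤s (≤-trans (m≤m*n ρ 2) (m≤n+m _ 3))) (m≤m+n Δ ((K + K) * Δ)))

  e₁e₂ : Edge (at (spine (suc ρ))) (at (spine (2 + ρ)))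
  e₁e₂ = adjacent (<⇒≤ 2+ρ≤top) 2+ρ≤top right

  e₂e₁ : Edge (at (spine (2 + ρ))) (at (spine (suc ρ)))
  e₂e₁ = adjacent 2+ρ≤top (<⇒≤ 2+ρ≤top) left

  enforces : ∀ {k} (k≤K : k ≤ K) → DiTTR.EnforcesEqual (gadget k≤K) e₁e₂ e₂e₁
  enforces k≤K lab valid = toℕ-injective (trans (sym (label-edge lab e₁e₂)) (trans
    (central-labels (labelsOf lab) (λ _ → bounded _ _) (λ _ → bounded _ _) (λ _ → bounded _ _) (λ _ → bounded _ _)
      (valid⇒tight k≤K lab valid))
    (label-edge lab e₂e₁)))
    where bounded = label-bounded lab

lemma18 : ∀ (Δ k : ℕ) → 1 ≤ k → k + 3 ≤ Δ → 2 ∣ Δ →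
    Σ[ I ∈ DiTTR Δ k ] (DiTTR.Realizable I ×
    (Σ[ e₁ ∈ DiTTR.Vertex I ] Σ[ e₂ ∈ DiTTR.Vertex I ]
    Σ[ e₁e₂ ∈ DiTTR.Edge I e₁ e₂ ] Σ[ e₂e₁ ∈ DiTTR.Edge I e₂ e₁ ]
    DiTTR.EnforcesEqual I {e₁} {e₂} e₁e₂ e₂e₁))
lemma18 Δ k 1≤k k+3≤Δ (divides 0 refl) = contradiction (≤-trans (m≤n+m 3 k) k+3≤Δ) λ ()
lemma18 Δ k 1≤k k+3≤Δ (divides 1 refl) = contradiction (≤-trans (m≤n+m 3 k) k+3≤Δ) λ where (s≤s (s≤s ()))
-- Here Δ = (ρ + 2) * 2 reduces to 4 + ρ * 2 = 3 + K.
lemma18 Δ k 1≤k k+3≤Δ (divides (suc (suc ρ)) refl) =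
  gadget k≤K , realizable k≤K , _ , _ , e₁e₂ , e₂e₁ , enforces k≤K
  where
  open Instance ρ
  k≤K : k ≤ 1 + ρ * 2
  k≤K = +-cancelʳ-≤ 3 _ _ (subst (k + 3 ≤_) (+-comm 3 (1 + ρ * 2)) k+3≤Δ)
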